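{- Let $p$ be a prime and let $q$ be a power of $p$ with $q\neq 2$ and $q\neq p^2$. Let $\ell$ be an odd prime such that $q$ is a primitive root modulo $\ell^t$ for each integer $t\geq 1$. Then $h_q(\ell^t)=0$.
   Context: For a prime power $q$ and $n\in\mathbb{N}$, let $e_0,\dots,e_{n-1}$ be the standard basis of $\mathbb{F}_q^n$ (indices mod $n$) and let $\tau:\mathbb{F}_q^n\to\mathbb{F}_q^n$ be the cyclic shift $\sum_i a_ie_i\mapsto\sum_i a_ie_{i+1}$. A subspace $U\subseteq\mathbb{F}_q^n$ is cyclically covering if $\bigcup_{i=0}^{n-1}\tau^i(U)=\mathbb{F}_q^n$. $h_q(n)$ denotes the largest codimension of a cyclically covering subspace of $\mathbb{F}_q^n$ (so $h_q(n)=0$ means the only cyclically covering subspace is $\mathbb{F}_q^n$ itself). -}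

module Defs where

open import Level using (0ℓ; suc)
open import Data.Nat as ℕ using (ℕ; zero; suc; _^_; _≤_; _<_)
open import Data.Nat.Coprimality using (Coprime; coprime?)
open import Data.Fin using (Fin; zero; suc; fromℕ; inject₁)
open import Data.List using (List; length; filter; upTo)
open import Data.Product using (Σ; ∃; _×_; _,_)
open import Relation.Nullary using (¬_)
open import Relation.Binary.PropositionalEquality as ≡ using (_≡_)
open import Function.Bundles using (Inverse)
open import Algebra.Bundles using (CommutativeRing)

infix 4 _≡_[mod_]
_≡_[mod_] : ℕ → ℕ → ℕ → Set
a ≡ b [mod m ] = ∃ λ x → ∃ λ y → a ℕ.+ x ℕ.* m ≡ b ℕ.+ y ℕ.* m

totient : ℕ → ℕ
totient m = length (filter (λ k → coprime? k m) (upTo m))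

PrimitiveRoot : ℕ → ℕ → Set
PrimitiveRoot q m =
  Coprime q m ×
  (q ^ totient m ≡ 1 [mod m ]) ×
  (∀ k → 1 ≤ k → k < totient m → ¬ (q ^ k ≡ 1 [mod m ]))

-- Finite fields with q elements (any two are isomorphic, so "𝔽_q" is
-- modelled as an arbitrary field together with a bijection with Fin q).

record FiniteField (q : ℕ) : Set₁ where
  field
    commRing : CommutativeRing 0ℓ 0ℓ
  open CommutativeRing commRing public
  field
    1≉0     : ¬ (1# ≈ 0#)
    inverse : ∀ x → ¬ (x ≈ 0#) → ∃ λ y → (x * y) ≈ 1#
    enum    : Inverse (≡.setoid (Fin q)) setoid

module _ {q : ℕ} (F : FiniteField q) where
  open FiniteField F

  Vec : ℕ → Set
  Vec n = Fin n → Carrier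

  _≋_ : ∀ {n} → Vec n → Vec n → Set
  u ≋ v = ∀ i → u i ≈ v i

  -- cyclic shift τ : Σ aᵢ eᵢ ↦ Σ aᵢ eᵢ₊₁, i.e. (τ a)_{i+1} = a_i
  τ : ∀ {n} → Vec n → Vec n
  τ {zero}  a ()
  τ {suc m} a zero    = a (fromℕ m)
  τ {suc m} a (suc i) = a (inject₁ i)

  τ^ : ∀ {n} → ℕ → Vec n → Vec n
  τ^ zero    a = a
  τ^ (suc i) a = τ (τ^ i a)

  record IsSubspace {n : ℕ} (U : Vec n → Set) : Set where
    field
      respects : ∀ {u v} → u ≋ v → U u → U v
      zero∈    : U (λ _ → 0#)
      +-closed : ∀ {u v} → U u → U v → U (λ i → u i + v i)
      ·-closed : ∀ c {u} → U u → U (λ i → c * u i)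

  CyclicallyCovering : ∀ {n} → (Vec n → Set) → Set
  CyclicallyCovering {n} U =
    ∀ v → ∃ λ i → i < n × ∃ λ u → U u × (τ^ i u ≋ v)

  hZero : ℕ → Set₁
  hZero n = (U : Vec n → Set) → IsSubspace U → CyclicallyCovering U → ∀ v → U v

{-# OPTIONS --safe #-}

-- If U is proper, it lies in the hyperplane orthogonal to some w ≠ 0, so it suffices to find a
-- vector x all of whose cyclic shifts have nonzero inner product with w: a nowhere zero element
-- of the ideal generated by w in R = F[X]/(Xⁿ - 1), n = ℓᵗ.  By Frobenius r(X) ^ q = r(X ^ q)
-- in R, hence w ^ (q ^ φ(n)) = w and w has a nonzero idempotent multiple e.  From e ^ q = e, the
-- coefficients of e are invariant under multiplication of the exponents by q; as q is a
-- primitive root, the coefficient at k depends only on the ℓ-adic valuation of k.  Such an e has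
-- a nowhere zero multiple because some ℓ nonzero elements of F, with repetition, sum to zero.

module Submission where

open import Defs hiding (_≋_)
import Defs
open import Level using (0ℓ)
open import Algebra.Bundles using (CommutativeMonoid; CommutativeRing; CommutativeSemiring)
import Algebra.Properties.CommutativeMonoid.Sum as MonoidSum
import Algebra.Properties.CommutativeSemigroup as CommutativeSemigroupProperties
import Algebra.Properties.CommutativeSemiring.Binomial as Binomial
import Algebra.Properties.Group as GroupProperties
import Algebra.Properties.Ring as RingProperties
import Algebra.Properties.Semiring.Exp as Exp
import Algebra.Properties.Semiring.Mult as Mult
import Algebra.Properties.Semiring.Sum as Sum
open import Algebra.Structures.Biased using (isCommutativeMonoidˡ; isCommutativeSemiringˡ)
open import Data.Fin as Fin using (Fin; zero; suc; toℕ; fromℕ; fromℕ<; inject₁; punchIn)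
open import Data.Fin.Permutation using (permutation)
open import Data.Fin.Properties using (pigeonhole; punchInᵢ≢i; suc-injective; toℕ<n; toℕ-fromℕ; toℕ-fromℕ<; toℕ-inject₁; toℕ-injective)
open import Data.Fin.Relation.Unary.Top using (view; ‵fromℕ; ‵inject₁)
open import Data.List using (List; []; _∷_; _++_; cartesianProductWith; filter; lookup; map; tabulate; upTo)
open import Data.List.Membership.Propositional using (_∈_; find)
open import Data.List.Membership.Propositional.Properties using (∈-cartesianProductWith⁺; ∈-filter⁺; ∈-map⁺; ∈-tabulate⁺; ∈-upTo⁺)
open import Data.List.Relation.Unary.All as All using (All; all?)
import Data.List.Relation.Unary.All.Properties as Allₚ
open import Data.List.Relation.Unary.Any using (here; index)
open import Data.List.Relation.Unary.Any.Properties using (lookup-index)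
open import Data.Nat as ℕ using (ℕ; zero; suc; _≤_; _<_; _%_; _/_; NonZero; s≤s; z≤n)
open import Data.Nat.Combinatorics using (_C_; k![n∸k]!∣n!; nCk≡n!/k![n-k]!; nCn≡1)
open import Data.Nat.Coprimality as Coprimality using (Coprime; coprime?; coprime-Bézout; coprime-divisor)
open import Data.Nat.Divisibility using (_∣_; _∤_; _∣?_; divides; m∣m*n; n∣m*n; ∣-refl; ∣-trans; ∣1⇒≡1; ∣m+n∣m⇒∣n; ∣n∣m%n⇒∣m; ∣⇒≤)
open import Data.Nat.DivMod using (+-distrib-/-∣ˡ; [m+kn]%n≡m%n; [m+n]%n≡m%n; m%n%n≡m%n; m%n<n; m*n/n≡m; m/n*n≡m; m<n⇒m%n≡m; m≡m%n+[m/n]*n)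
open import Data.Nat.GCD using (module Bézout)
open import Data.Nat.Primality using (Prime; euclidsLemma; prime⇒irreducible; prime⇒nonTrivial; prime⇒nonZero)
import Data.Nat.Properties as ℕₚ
open import Data.Nat.Solver using (module +-*-Solver)
open import Data.Product using (_×_; _,_; ∃; ∃₂)
open import Data.Sum using (_⊎_; inj₁; inj₂)
open import Data.Vec.Functional using (removeAt)
import Data.Vec.Functional as Vector
open import Function using (Inverse; _∘_)
import Relation.Binary.Reasoning.Setoid as SetoidReasoning
open import Relation.Binary.PropositionalEquality as ≡ using (_≡_; _≢_)
open import Relation.Binary.Structures using (IsEquivalence)
open import Relation.Nullary using (¬_; Dec; contradiction; no; yes)
open import Relation.Nullary.Decidable using (map′)

-- A class modulo Xⁿ - 1 is handled through its pairing with functions ℕ → F of period n, and a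
-- vector is one period of such a function. The inner products of `w` with the shifts of `g` are the
-- values `∫ w (shift i g)`. A function of period h also has period ℓh, so one and the same
-- polynomial can be read modulo Xⁿ - 1 for several n without any quotient map; the induction on t
-- relies on this. Replacing `w` by a multiple `w ⊛ s` loses nothing: the values that `w ⊛ s` takes
-- on the shifts of `g` are those that `w` takes on the shifts of `i ↦ ∫ s (shift i g)`. What is
-- gained is that an invariant e has at most t + 1 different coefficients, those at 0 and at ℓᵃ for
-- a < t.

-- Congruences, powers of a primitive root, ℓ-adic valuations, binomial coefficients

module Arithmetic where
  open import Data.Nat using (_+_; _*_; _∸_; _^_; _!)
  open ≡ using (refl; sym; trans; cong; subst; subst₂)

  mod-sym : ∀ {m a b} → a ≡ b [mod m ] → b ≡ a [mod m ]
  mod-sym (x , y , eq) = y , x , sym eq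

  mod-trans : ∀ {m a b c} → a ≡ b [mod m ] → b ≡ c [mod m ] → a ≡ c [mod m ]
  mod-trans {m} {a} {b} {c} (x , y , p) (u , v , r) = x + u , v + y , (begin
    a + (x + u) * m      ≡⟨ solve 4 (λ a x u m → a :+ (x :+ u) :* m := (a :+ x :* m) :+ u :* m) refl a x u m ⟩
    (a + x * m) + u * m  ≡⟨ cong (_+ u * m) p ⟩
    (b + y * m) + u * m  ≡⟨ solve 4 (λ b y u m → (b :+ y :* m) :+ u :* m := (b :+ u :* m) :+ y :* m) refl b y u m ⟩
    (b + u * m) + y * m  ≡⟨ cong (_+ y * m) r ⟩
    (c + v * m) + y * m  ≡⟨ solve 4 (λ c v y m → (c :+ v :* m) :+ y :* m := c :+ (v :+ y) :* m) refl c v y m ⟩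
    c + (v + y) * m      ∎)
    where open ≡.≡-Reasoning
          open +-*-Solver

  mod-*ˡ : ∀ {m a b} c → a ≡ b [mod m ] → c * a ≡ c * b [mod m ]
  mod-*ˡ {m} {a} {b} c (x , y , p) = c * x , c * y , (begin
    c * a + c * x * m  ≡⟨ solve 4 (λ a c x m → c :* a :+ c :* x :* m := c :* (a :+ x :* m)) refl a c x m ⟩
    c * (a + x * m)    ≡⟨ cong (c *_) p ⟩
    c * (b + y * m)    ≡⟨ solve 4 (λ a c x m → c :* a :+ c :* x :* m := c :* (a :+ x :* m)) refl b c y m ⟨
    c * b + c * y * m  ∎)
    where open ≡.≡-Reasoning
          open +-*-Solver

  mod-*-lift : ∀ {m a b} c → a ≡ b [mod m ] → c * a ≡ c * b [mod c * m ]
  mod-*-lift {m} {a} {b} c (x , y , p) = x , y , (begin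
    c * a + x * (c * m)  ≡⟨ solve 4 (λ a c x m → c :* a :+ x :* (c :* m) := c :* (a :+ x :* m)) refl a c x m ⟩
    c * (a + x * m)      ≡⟨ cong (c *_) p ⟩
    c * (b + y * m)      ≡⟨ solve 4 (λ a c x m → c :* a :+ x :* (c :* m) := c :* (a :+ x :* m)) refl b c y m ⟨
    c * b + y * (c * m)  ∎)
    where open ≡.≡-Reasoning
          open +-*-Solver

  %⇒mod : ∀ {m a b} .{{_ : NonZero m}} → a % m ≡ b % m → a ≡ b [mod m ]
  %⇒mod {m} {a} {b} eq = b / m , a / m , (begin
    a + b / m * m                    ≡⟨ cong (_+ b / m * m) (m≡m%n+[m/n]*n a m) ⟩
    a % m + a / m * m + b / m * m    ≡⟨ cong (λ r → r + a / m * m + b / m * m) eq ⟩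
    b % m + a / m * m + b / m * m    ≡⟨ solve 3 (λ r x y → r :+ x :+ y := (r :+ y) :+ x) refl (b % m) (a / m * m) (b / m * m) ⟩
    b % m + b / m * m + a / m * m    ≡⟨ cong (_+ a / m * m) (m≡m%n+[m/n]*n b m) ⟨
    b + a / m * m                    ∎)
    where open ≡.≡-Reasoning
          open +-*-Solver

  mod⇒% : ∀ {m a b} .{{_ : NonZero m}} → a ≡ b [mod m ] → a % m ≡ b % m
  mod⇒% {m} {a} {b} (x , y , eq) = begin
    a % m            ≡⟨ [m+kn]%n≡m%n a x m ⟨
    (a + x * m) % m  ≡⟨ cong (_% m) eq ⟩
    (b + y * m) % m  ≡⟨ [m+kn]%n≡m%n b y m ⟩
    b % m            ∎
    where open ≡.≡-Reasoning

  coprime-*ˡ : ∀ {a b m} → Coprime a m → Coprime b m → Coprime (a * b) m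
  coprime-*ˡ {a} {b} a⊥m b⊥m {d} (d∣ab , d∣m) = b⊥m (coprime-divisor d⊥a d∣ab , d∣m)
    where
    d⊥a : Coprime d a
    d⊥a (e∣d , e∣a) = a⊥m (e∣a , ∣-trans e∣d d∣m)

  coprime-^ˡ : ∀ {a m} k → Coprime a m → Coprime (a ^ k) m
  coprime-^ˡ zero    a⊥m (d∣1 , _) = ∣1⇒≡1 d∣1
  coprime-^ˡ (suc k) a⊥m = coprime-*ˡ a⊥m (coprime-^ˡ k a⊥m)

  prime∤⇒coprime-^ : ∀ {ℓ u} → Prime ℓ → ℓ ∤ u → ∀ k → Coprime u (ℓ ^ k)
  prime∤⇒coprime-^ {ℓ} {u} ℓ-prime ℓ∤u k = Coprimality.sym (coprime-^ˡ k ℓ⊥u)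
    where
    ℓ⊥u : Coprime ℓ u
    ℓ⊥u (d∣ℓ , d∣u) with prime⇒irreducible ℓ-prime d∣ℓ
    ... | inj₁ d≡1  = d≡1
    ... | inj₂ refl = contradiction d∣u ℓ∤u

  module _ {q m : ℕ} .{{_ : NonZero m}} (q-root : PrimitiveRoot q m) where

    private
      q⊥m : Coprime q m
      q⊥m = let c , _ = q-root in c

      q^φ≡1 : q ^ totient m ≡ 1 [mod m ]
      q^φ≡1 = let _ , e , _ = q-root in e

      units : List ℕ
      units = filter (λ k → coprime? k m) (upTo m)

      residue∈units : ∀ {u} → Coprime u m → u % m ∈ units
      residue∈units u⊥m = ∈-filter⁺ (λ k → coprime? k m) (∈-upTo⁺ (m%n<n _ m))
        λ (d∣u%m , d∣m) → u⊥m (∣n∣m%n⇒∣m d∣m d∣u%m , d∣m)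

      index-injective : ∀ {xs : List ℕ} {a b} (p : a ∈ xs) (r : b ∈ xs) → index p ≡ index r → a ≡ b
      index-injective {xs} p r eq = trans (lookup-index p) (trans (cong (lookup xs) eq) (sym (lookup-index r)))

      candidates : ℕ → Fin (suc (totient m)) → ℕ
      candidates u zero    = u
      candidates u (suc i) = q ^ toℕ i

      candidates-coprime : ∀ {u} → Coprime u m → ∀ i → Coprime (candidates u i) m
      candidates-coprime u⊥m zero    = u⊥m
      candidates-coprime u⊥m (suc i) = coprime-^ˡ (toℕ i) q⊥m

    -- The residues of `u` and of q⁰, ..., q^(φ-1) are φ + 1 entries of `units`, a list of length φ
    -- = `totient m`, so two of them coincide. Two of the powers cannot, since the order of q would
    -- then be less than φ; hence `u` meets a power.
    unit≡power : ∀ {u} → Coprime u m → ∃ λ i → u ≡ q ^ i [mod m ]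
    unit≡power {u} u⊥m
      with pigeonhole (ℕₚ.n<1+n _) (λ i → index (residue∈units (candidates-coprime u⊥m i)))
    ... | zero , suc j , _ , eq = toℕ j ,
      %⇒mod (index-injective (residue∈units u⊥m) (residue∈units (coprime-^ˡ (toℕ j) q⊥m)) eq)
    ... | suc i , suc j , s≤s i<j , eq =
      contradiction q^[j∸i]≡1
        (no-smaller (toℕ j ∸ toℕ i) (ℕₚ.m<n⇒0<n∸m i<j) (ℕₚ.≤-<-trans (ℕₚ.m∸n≤m (toℕ j) (toℕ i)) (toℕ<n j)))
      where
      no-smaller : ∀ k → 1 ≤ k → k < totient m → ¬ (q ^ k ≡ 1 [mod m ])
      no-smaller = let _ , _ , s = q-root in s

      -- `q ^ φ-i` is inverse to q^i modulo `m`; multiplying by it turns the collision of q^i and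
      -- q^j into q^(j-i) ≡ 1.
      φ-i : ℕ
      φ-i = totient m ∸ toℕ i

      q^i≡q^j : q ^ toℕ i ≡ q ^ toℕ j [mod m ]
      q^i≡q^j = %⇒mod (index-injective (residue∈units (coprime-^ˡ (toℕ i) q⊥m))
                                       (residue∈units (coprime-^ˡ (toℕ j) q⊥m)) eq)

      φ-i+i : φ-i + toℕ i ≡ totient m
      φ-i+i = ℕₚ.m∸n+n≡m (ℕₚ.<⇒≤ (toℕ<n i))

      q^φ≡q^[φ-i]q^i : q ^ φ-i * q ^ toℕ i ≡ q ^ totient m
      q^φ≡q^[φ-i]q^i = trans (sym (ℕₚ.^-distribˡ-+-* q φ-i (toℕ i))) (cong (q ^_) φ-i+i)

      q^[φ-i]q^j : q ^ φ-i * q ^ toℕ j ≡ q ^ (toℕ j ∸ toℕ i) * q ^ totient m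
      q^[φ-i]q^j = begin
        q ^ φ-i * q ^ toℕ j                        ≡⟨ ℕₚ.^-distribˡ-+-* q φ-i (toℕ j) ⟨
        q ^ (φ-i + toℕ j)                          ≡⟨ cong (λ x → q ^ (φ-i + x)) (ℕₚ.m∸n+n≡m (ℕₚ.<⇒≤ i<j)) ⟨
        q ^ (φ-i + (toℕ j ∸ toℕ i + toℕ i))        ≡⟨ cong (q ^_) (solve 3 (λ a b c → a :+ (b :+ c) := b :+ (a :+ c)) refl φ-i (toℕ j ∸ toℕ i) (toℕ i)) ⟩
        q ^ (toℕ j ∸ toℕ i + (φ-i + toℕ i))        ≡⟨ cong (λ x → q ^ (toℕ j ∸ toℕ i + x)) φ-i+i ⟩
        q ^ (toℕ j ∸ toℕ i + totient m)            ≡⟨ ℕₚ.^-distribˡ-+-* q (toℕ j ∸ toℕ i) (totient m) ⟩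
        q ^ (toℕ j ∸ toℕ i) * q ^ totient m        ∎
        where open ≡.≡-Reasoning
              open +-*-Solver

      q^[j∸i]≡1 : q ^ (toℕ j ∸ toℕ i) ≡ 1 [mod m ]
      q^[j∸i]≡1 = mod-trans
        (subst (_≡ q ^ φ-i * q ^ toℕ j [mod m ]) (ℕₚ.*-identityʳ _)
          (mod-sym (subst (_≡ q ^ (toℕ j ∸ toℕ i) * 1 [mod m ]) (sym q^[φ-i]q^j) (mod-*ˡ (q ^ (toℕ j ∸ toℕ i)) q^φ≡1))))
        (mod-trans (mod-*ˡ (q ^ φ-i) (mod-sym q^i≡q^j)) (subst (_≡ 1 [mod m ]) (sym q^φ≡q^[φ-i]q^i) q^φ≡1))

    totient>0 : 0 < totient m
    totient>0 with totient m | index (residue∈units q⊥m)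
    ... | suc _ | _ = s≤s z≤n

    q-cancel : ∀ {a b} → q * a ≡ q * b [mod m ] → a ≡ b [mod m ]
    q-cancel {a} {b} qa≡qb with totient m | q^φ≡1 | totient>0
    ... | suc φ | q^[1+φ]≡1 | _ = mod-trans (mod-sym (step a)) (mod-trans (mod-*ˡ (q ^ φ) qa≡qb) (step b))
      where
      open ≡.≡-Reasoning
      open +-*-Solver

      step : ∀ c → q ^ φ * (q * c) ≡ c [mod m ]
      step c = subst₂ (λ x y → x ≡ y [mod m ])
        (solve 3 (λ c q r → c :* (q :* r) := r :* (q :* c)) refl c q (q ^ φ))
        (ℕₚ.*-identityʳ c) (mod-*ˡ c q^[1+φ]≡1)

  ℓ-adic : ∀ {ℓ} → Prime ℓ → ∀ t {j} → 0 < j → j < ℓ ^ t →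
           ∃₂ λ a u → a < t × j ≡ ℓ ^ a * u × ℓ ∤ u
  ℓ-adic ℓ-prime zero    0<j j<1 = contradiction (ℕₚ.≤-trans j<1 0<j) (ℕₚ.n≮n _)
  ℓ-adic {ℓ} ℓ-prime (suc t) {j} 0<j j<ℓ^[1+t] with ℓ ∣? j
  ... | no ℓ∤j = 0 , j , s≤s z≤n , sym (ℕₚ.*-identityˡ j) , ℓ∤j
  ... | yes (divides c refl)
    with ℓ-adic ℓ-prime t {c} (ℕₚ.n≢0⇒n>0 λ { refl → contradiction 0<j (ℕₚ.n≮n _) })
           (ℕₚ.*-cancelˡ-< ℓ c (ℓ ^ t) (subst (_< ℓ ^ suc t) (ℕₚ.*-comm c ℓ) j<ℓ^[1+t]))
  ... | a , u , a<t , c≡ , ℓ∤u = suc a , u , s≤s a<t , eq , ℓ∤u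
    where
    eq : c * ℓ ≡ ℓ ^ suc a * u
    eq = trans (ℕₚ.*-comm c ℓ) (trans (cong (ℓ *_) c≡) (sym (ℕₚ.*-assoc ℓ (ℓ ^ a) u)))

  prime∤! : ∀ {p} → Prime p → ∀ {k} → k < p → p ∤ k !
  prime∤! p-prime {zero}  _   p∣1 = contradiction (subst Prime (∣1⇒≡1 p∣1) p-prime) λ ()
  prime∤! p-prime {suc k} k<p p∣ with euclidsLemma (suc k) (k !) p-prime p∣
  ... | inj₁ p∣1+k = contradiction (∣⇒≤ p∣1+k) (ℕₚ.<⇒≱ k<p)
  ... | inj₂ p∣k!  = prime∤! p-prime (ℕₚ.<⇒≤ k<p) p∣k!

  prime∣C : ∀ {p} → Prime p → ∀ {k} → 0 < k → k < p → p ∣ (p C k)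
  prime∣C {p} p-prime {k} 0<k k<p
    with euclidsLemma (p C k) (k ! * (p ∸ k) !) p-prime p∣C*k![p∸k]!
    where
    instance
      _ = k ℕₚ.!* (p ∸ k) !≢0
      _ = prime⇒nonZero p-prime

    p∣C*k![p∸k]! : p ∣ (p C k) * (k ! * (p ∸ k) !)
    p∣C*k![p∸k]! = subst (p ∣_)
      (sym (trans (cong (_* (k ! * (p ∸ k) !)) (nCk≡n!/k![n-k]! (ℕₚ.<⇒≤ k<p))) (m/n*n≡m (k![n∸k]!∣n! (ℕₚ.<⇒≤ k<p)))))
      (n∣n! p)
      where
      n∣n! : ∀ n .{{_ : NonZero n}} → n ∣ n !
      n∣n! (suc n) = m∣m*n (n !)
  ... | inj₁ p∣C = p∣C
  ... | inj₂ p∣k![p∸k]! with euclidsLemma (k !) ((p ∸ k) !) p-prime p∣k![p∸k]!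
  ...   | inj₁ p∣k!     = contradiction p∣k! (prime∤! p-prime k<p)
  ...   | inj₂ p∣[p∸k]! = contradiction p∣[p∸k]! (prime∤! p-prime (ℕₚ.∸-monoʳ-< 0<k (ℕₚ.<⇒≤ k<p)))

  -- The shape 3 + 2r is that of the zero sum built later: one triple, then r cancelling pairs.
  odd-prime≡3+2r : ∀ {ℓ} → Prime ℓ → ℓ ≢ 2 → ∃ λ r → ℓ ≡ 3 + r * 2
  odd-prime≡3+2r {ℓ} ℓ-prime ℓ≢2 with ℓ % 2 | m%n<n ℓ 2 | ℓ / 2 | m≡m%n+[m/n]*n ℓ 2
  ... | 0 | _ | r     | ℓ≡ with prime⇒irreducible ℓ-prime (divides r ℓ≡)
  ...   | inj₂ 2≡ℓ = contradiction (sym 2≡ℓ) ℓ≢2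
  odd-prime≡3+2r ℓ-prime ℓ≢2 | 1 | _ | zero  | ℓ≡1 = contradiction (subst Prime ℓ≡1 ℓ-prime) λ ()
  odd-prime≡3+2r ℓ-prime ℓ≢2 | 1 | _ | suc r | ℓ≡  = r , ℓ≡
  odd-prime≡3+2r ℓ-prime ℓ≢2 | suc (suc _) | s≤s (s≤s ()) | _ | _

open Arithmetic

-- Frobenius and idempotents in commutative semirings

module _ {c ℓ} (S : CommutativeSemiring c ℓ) where
  open CommutativeSemiring S hiding (zero)
  open Exp semiring
  open Mult semiring renaming (_×_ to _·_)
  open Sum semiring
  open SetoidReasoning setoid

  sum≈0 : ∀ {n} (f : Fin n → Carrier) → (∀ i → f i ≈ 0#) → sum f ≈ 0#
  sum≈0 {n} f f≈0 = trans (sum-cong-≋ f≈0) (sum-replicate-zero n)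

  ∣⇒·≈0 : ∀ {p n} → p · 1# ≈ 0# → p ∣ n → ∀ x → n · x ≈ 0#
  ∣⇒·≈0 {p} p·1≈0 (divides d ≡.refl) x = begin
    (d ℕ.* p) · x        ≈⟨ ×-congʳ (d ℕ.* p) (*-identityˡ x) ⟨
    (d ℕ.* p) · (1# * x) ≈⟨ ×-assoc-* (d ℕ.* p) 1# x ⟨
    (d ℕ.* p) · 1# * x   ≈⟨ *-congʳ (×1-homo-* d p) ⟩
    d · 1# * (p · 1#) * x ≈⟨ *-congʳ (*-congˡ p·1≈0) ⟩
    d · 1# * 0# * x      ≈⟨ *-congʳ (zeroʳ _) ⟩
    0# * x               ≈⟨ zeroˡ x ⟩
    0#                   ∎

  module _ {p} (p-prime : Prime p) (p·1≈0 : p · 1# ≈ 0#) where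

    -- The inner binomial coefficients are multiples of p. No subtraction occurs, so this applies to
    -- the group ring, which is set up as a semiring only.
    ^p-distrib-+ : ∀ x y → (x + y) ^ p ≈ x ^ p + y ^ p
    ^p-distrib-+ x y = go p p-prime p·1≈0
      where
      go : ∀ p → Prime p → p · 1# ≈ 0# → (x + y) ^ p ≈ x ^ p + y ^ p
      go (suc n) pr p·1≈0 = begin
        (x + y) ^ suc n                               ≈⟨ Binomial.theorem S (suc n) x y ⟩
        term zero + sum (term ∘ suc)                  ≈⟨ +-congˡ (sum-init-last (term ∘ suc)) ⟩
        term zero + (sum (term ∘ suc ∘ inject₁) + term (fromℕ (suc n)))
                                                      ≈⟨ +-cong first (+-cong (sum≈0 _ middle) last) ⟩
        y ^ suc n + (0# + x ^ suc n)                  ≈⟨ +-congˡ (+-identityˡ _) ⟩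
        y ^ suc n + x ^ suc n                         ≈⟨ +-comm _ _ ⟩
        x ^ suc n + y ^ suc n                         ∎
        where
        term : Fin (suc (suc n)) → Carrier
        term = Binomial.binomialTerm S x y (suc n)

        first : term zero ≈ y ^ suc n
        first = trans (×-homo-1 _) (*-identityˡ _)

        middle : ∀ i → term (suc (inject₁ i)) ≈ 0#
        middle i = ∣⇒·≈0 p·1≈0 (prime∣C pr (s≤s z≤n)
          (s≤s (≡.subst (_< n) (≡.sym (toℕ-inject₁ i)) (toℕ<n i)))) _

        last : term (fromℕ (suc n)) ≈ x ^ suc n
        last = begin
          term (fromℕ (suc n)) ≡⟨ ≡.cong (λ k → (suc n C k) · (x ^ k * y ^ (suc n ℕ.∸ k))) (toℕ-fromℕ (suc n)) ⟩
          (suc n C suc n) · (x ^ suc n * y ^ (n ℕ.∸ n)) ≡⟨ ≡.cong₂ (λ a b → a · (x ^ suc n * y ^ b)) (nCn≡1 (suc n)) (ℕₚ.n∸n≡0 n) ⟩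
          1 · (x ^ suc n * 1#)  ≈⟨ ×-homo-1 _ ⟩
          x ^ suc n * 1#        ≈⟨ *-identityʳ _ ⟩
          x ^ suc n             ∎

    ^p^k-distrib-+ : ∀ k x y → (x + y) ^ (p ℕ.^ k) ≈ x ^ (p ℕ.^ k) + y ^ (p ℕ.^ k)
    ^p^k-distrib-+ zero    x y = distribʳ 1# x y
    ^p^k-distrib-+ (suc k) x y = begin
      (x + y) ^ (p ℕ.* P)          ≈⟨ ^-assocʳ (x + y) p P ⟨
      ((x + y) ^ p) ^ P            ≈⟨ ^-congˡ P (^p-distrib-+ x y) ⟩
      (x ^ p + y ^ p) ^ P          ≈⟨ ^p^k-distrib-+ k (x ^ p) (y ^ p) ⟩
      (x ^ p) ^ P + (y ^ p) ^ P    ≈⟨ +-cong (^-assocʳ x p P) (^-assocʳ y p P) ⟩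
      x ^ (p ℕ.* P) + y ^ (p ℕ.* P) ∎
      where P = p ℕ.^ k

  -- For m ≥ 1, regroup w^m w^m as w^(m-1) w^(m+1) = w^(m-1) w. No inverse of w is involved, so zero
  -- divisors are allowed.
  w^[1+m]≈w⇒w^m-idempotent : ∀ w m → w ^ suc m ≈ w → w ^ m * w ^ m ≈ w ^ m
  w^[1+m]≈w⇒w^m-idempotent w zero    _  = *-identityˡ 1#
  w^[1+m]≈w⇒w^m-idempotent w (suc m) eq = begin
    w * w ^ m * e    ≈⟨ *-congʳ (*-comm w (w ^ m)) ⟩
    w ^ m * w * e    ≈⟨ *-assoc (w ^ m) w e ⟩
    w ^ m * (w * e)  ≈⟨ *-congˡ eq ⟩
    w ^ m * w        ≈⟨ *-comm (w ^ m) w ⟩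
    e                ∎
    where
    e : Carrier
    e = w ^ suc m

  idempotent-^ : ∀ {e} → e * e ≈ e → ∀ m → e ^ suc m ≈ e
  idempotent-^ ee≈e zero    = *-identityʳ _
  idempotent-^ ee≈e (suc m) = trans (*-congˡ (idempotent-^ ee≈e m)) ee≈e

-- Finite fields: characteristic, x^q = x, integers that stay nonzero

module FieldProperties {q : ℕ} (F : FiniteField q) where
  open FiniteField F hiding (zero)
  open Exp semiring
  open Mult semiring renaming (_×_ to _·_)
  open SetoidReasoning setoid
  private module E = Inverse enum

  private
    to-from : ∀ x → E.to (E.from x) ≈ x
    to-from x = E.inverseˡ ≡.refl

  infix 4 _≟_
  _≟_ : ∀ x y → Dec (x ≈ y)
  x ≟ y = map′ from-injective E.from-cong (E.from x Fin.≟ E.from y)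
    where
    from-injective : E.from x ≡ E.from y → x ≈ y
    from-injective eq = trans (sym (to-from x)) (trans (E.to-cong eq) (to-from y))

  *-cancelˡ-≈0 : ∀ {x y} → ¬ (x ≈ 0#) → x * y ≈ 0# → y ≈ 0#
  *-cancelˡ-≈0 {x} {y} x≉0 xy≈0 with x⁻¹ , xx⁻¹≈1 ← inverse x x≉0 = begin
    y               ≈⟨ *-identityˡ y ⟨
    1# * y          ≈⟨ *-congʳ xx⁻¹≈1 ⟨
    x * x⁻¹ * y     ≈⟨ *-congʳ (*-comm x x⁻¹) ⟩
    x⁻¹ * x * y     ≈⟨ *-assoc x⁻¹ x y ⟩
    x⁻¹ * (x * y)   ≈⟨ *-congˡ xy≈0 ⟩
    x⁻¹ * 0#        ≈⟨ zeroʳ x⁻¹ ⟩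
    0#              ∎

  *-≉0 : ∀ {x y} → ¬ (x ≈ 0#) → ¬ (y ≈ 0#) → ¬ (x * y ≈ 0#)
  *-≉0 x≉0 y≉0 = y≉0 ∘ *-cancelˡ-≈0 x≉0

  *-cancelʳ-≈1 : ∀ {x y} → ¬ (y ≈ 0#) → x * y ≈ y → x ≈ 1#
  *-cancelʳ-≈1 {x} {y} y≉0 xy≈y with y⁻¹ , yy⁻¹≈1 ← inverse y y≉0 = begin
    x               ≈⟨ *-identityʳ x ⟨
    x * 1#          ≈⟨ *-congˡ yy⁻¹≈1 ⟨
    x * (y * y⁻¹)   ≈⟨ *-assoc x y y⁻¹ ⟨
    x * y * y⁻¹     ≈⟨ *-congʳ xy≈y ⟩
    y * y⁻¹         ≈⟨ yy⁻¹≈1 ⟩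
    1#              ∎

  module _ (M : CommutativeMonoid 0ℓ 0ℓ) where
    private module M = CommutativeMonoid M
    open MonoidSum M using (sum; sum-permute; sum-cong-≋)

    -- The monoid is arbitrary so that the additive one can serve `q·1≈0` and the multiplicative one
    -- `x^q≈x`.
    sum-reindex : (f : Carrier → M.Carrier) → (∀ {x y} → x ≈ y → f x M.≈ f y) →
                  (φ ψ : Carrier → Carrier) →
                  (∀ {x y} → x ≈ y → φ x ≈ φ y) → (∀ {x y} → x ≈ y → ψ x ≈ ψ y) →
                  (∀ x → φ (ψ x) ≈ x) → (∀ x → ψ (φ x) ≈ x) →
                  sum (f ∘ E.to) M.≈ sum (f ∘ φ ∘ E.to)
    sum-reindex f f-cong φ ψ φ-cong ψ-cong φψ ψφ = M.trans
      (sum-permute (f ∘ E.to) (permutation (conj φ) (conj ψ) (conj-inverse φ-cong φψ) (conj-inverse ψ-cong ψφ)))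
      (sum-cong-≋ {q} (λ i → f-cong (to-from (φ (E.to i)))))
      where
      conj : (Carrier → Carrier) → Fin q → Fin q
      conj χ i = E.from (χ (E.to i))

      conj-inverse : ∀ {χ ω} → (∀ {x y} → x ≈ y → χ x ≈ χ y) → (∀ x → χ (ω x) ≈ x) →
                     ∀ i → conj χ (conj ω i) ≡ i
      conj-inverse {ω = ω} χ-cong χω i = ≡.trans
        (E.from-cong (trans (χ-cong (to-from (ω (E.to i)))) (χω (E.to i)))) (E.inverseʳ refl)

  -- Translating by 1 permutes F, so Σ x = Σ (x + 1) = Σ x + q · 1.
  q·1≈0 : q · 1# ≈ 0#
  q·1≈0 = begin
    q · 1#                    ≈⟨ +-identityˡ _ ⟨
    0# + q · 1#               ≈⟨ +-congʳ (-‿inverseˡ Σx) ⟨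
    - Σx + Σx + q · 1#        ≈⟨ +-assoc _ _ _ ⟩
    - Σx + (Σx + q · 1#)      ≈⟨ +-congˡ Σx+q≈Σx ⟩
    - Σx + Σx                 ≈⟨ -‿inverseˡ Σx ⟩
    0#                        ∎
    where
    open Sum semiring

    Σx : Carrier
    Σx = sum E.to

    Σx+q≈Σx : Σx + q · 1# ≈ Σx
    Σx+q≈Σx = begin
      Σx + q · 1#               ≈⟨ +-congˡ (sum-replicate q) ⟨
      Σx + sum {q} (λ _ → 1#)   ≈⟨ ∑-distrib-+ E.to (λ _ → 1#) ⟨
      sum (λ i → E.to i + 1#)   ≈⟨ sum-reindex +-commutativeMonoid (λ x → x) (λ e → e) (_+ 1#) (_+ - 1#) +-congʳ +-congʳ
                                     (λ x → trans (+-assoc x _ _) (trans (+-congˡ (-‿inverseˡ 1#)) (+-identityʳ x)))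
                                     (λ x → trans (+-assoc x _ _) (trans (+-congˡ (-‿inverseʳ 1#)) (+-identityʳ x))) ⟨
      Σx                        ∎

  product-≉0 : ∀ {n} (f : Fin n → Carrier) → (∀ i → ¬ (f i ≈ 0#)) →
               ¬ (MonoidSum.sum *-commutativeMonoid f ≈ 0#)
  product-≉0 {zero}  f f≉0 = 1≉0
  product-≉0 {suc n} f f≉0 = *-≉0 (f≉0 zero) (product-≉0 (f ∘ suc) (f≉0 ∘ suc))

  private
    if≈0 : Carrier → Carrier → Carrier → Carrier
    if≈0 x y z with x ≟ 0#
    ... | yes _ = y
    ... | no  _ = z

    if≈0-yes : ∀ {x y z} → x ≈ 0# → if≈0 x y z ≈ y
    if≈0-yes {x} x≈0 with x ≟ 0#
    ... | yes _  = refl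
    ... | no x≉0 = contradiction x≈0 x≉0

    if≈0-no : ∀ {x y z} → ¬ (x ≈ 0#) → if≈0 x y z ≈ z
    if≈0-no {x} x≉0 with x ≟ 0#
    ... | yes x≈0 = contradiction x≈0 x≉0
    ... | no _    = refl

  -- Counts the factors x when a single factor is exceptional. The extra x on the left makes the
  -- exponent n rather than n - 1, so that x^q appears directly.
  x*∏≈fi*x^n : ∀ {n} x (f : Fin n → Carrier) i → (∀ j → j ≢ i → f j ≈ x) →
               x * MonoidSum.sum *-commutativeMonoid f ≈ f i * x ^ n
  x*∏≈fi*x^n {suc n} x f i f≈x = begin
    x * ∏ f                        ≈⟨ *-congˡ (sum-remove {i = i} f) ⟩
    x * (f i * ∏ (removeAt f i))   ≈⟨ *-congˡ (*-congˡ (trans (sum-cong-≋ (λ j → f≈x (punchIn i j) (punchInᵢ≢i i j))) (sum-replicate n))) ⟩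
    x * (f i * x ^ n)              ≈⟨ *-assoc x (f i) (x ^ n) ⟨
    x * f i * x ^ n                ≈⟨ *-congʳ (*-comm x (f i)) ⟩
    f i * x * x ^ n                ≈⟨ *-assoc (f i) x (x ^ n) ⟩
    f i * (x * x ^ n)              ∎
    where open MonoidSum *-commutativeMonoid using (sum-remove; sum-cong-≋; sum-replicate) renaming (sum to ∏)

  -- The element of `Fin n` is evidence that n is positive; for n = 0 the power would be 1.
  0^n≈0 : ∀ {n} → Fin n → 0# ^ n ≈ 0#
  0^n≈0 {suc n} _ = zeroˡ _

  -- Multiplication by x ≉ 0 permutes the nonzero elements, so their product P satisfies
  -- P = x ^ (q - 1) * P.  The factor 0 of the product over all of F is replaced by 1.
  x^q≈x : ∀ x → x ^ q ≈ x
  x^q≈x x with x ≟ 0#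
  ... | yes x≈0 = trans (^-congˡ q x≈0) (trans (0^n≈0 (E.from 0#)) (sym x≈0))
  ... | no  x≉0 with x⁻¹ , xx⁻¹≈1 ← inverse x x≉0 = begin
    x ^ q                              ≈⟨ *-identityˡ _ ⟨
    1# * x ^ q                         ≈⟨ *-congʳ (if≈0-yes (to-from 0#)) ⟨
    h (E.to i₀) * x ^ q                ≈⟨ x*∏≈fi*x^n x (h ∘ E.to) i₀ (λ j j≢i₀ → if≈0-no (λ toj≈0 → j≢i₀ (≡.sym (E.inverseʳ (sym toj≈0))))) ⟨
    x * ∏ (h ∘ E.to)                   ≈⟨ *-congˡ (*-cancelʳ-≈1 (product-≉0 (g ∘ E.to) (λ i → g≉0 (E.to i))) ∏h∏g≈∏g) ⟩
    x * 1#                             ≈⟨ *-identityʳ x ⟩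
    x                                  ∎
    where
    open MonoidSum *-commutativeMonoid using (sum-cong-≋; ∑-distrib-+) renaming (sum to ∏)

    i₀ : Fin q
    i₀ = E.from 0#

    -- `g` gives the factors of the product and `h` the ratio g(xy) / g(y), which is x except at y =
    -- 0, where it is 1.
    g h : Carrier → Carrier
    g y = if≈0 y 1# y
    h y = if≈0 y 1# x

    g≉0 : ∀ y → ¬ (g y ≈ 0#)
    g≉0 y with y ≟ 0#
    ... | yes _  = 1≉0
    ... | no y≉0 = y≉0

    g-cong : ∀ {y z} → y ≈ z → g y ≈ g z
    g-cong {y} {z} y≈z with y ≟ 0# | z ≟ 0#
    ... | yes _   | yes _   = refl
    ... | yes y≈0 | no z≉0  = contradiction (trans (sym y≈z) y≈0) z≉0
    ... | no y≉0  | yes z≈0 = contradiction (trans y≈z z≈0) y≉0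
    ... | no _    | no _    = y≈z

    g-* : ∀ y → g (x * y) ≈ h y * g y
    g-* y with y ≟ 0#
    ... | yes y≈0 = trans (if≈0-yes (trans (*-congˡ y≈0) (zeroʳ x))) (sym (*-identityˡ 1#))
    ... | no y≉0  = if≈0-no (*-≉0 x≉0 y≉0)

    ∏h∏g≈∏g : ∏ (h ∘ E.to) * ∏ (g ∘ E.to) ≈ ∏ (g ∘ E.to)
    ∏h∏g≈∏g = begin
      ∏ (h ∘ E.to) * ∏ (g ∘ E.to)          ≈⟨ ∑-distrib-+ (h ∘ E.to) (g ∘ E.to) ⟨
      ∏ (λ i → h (E.to i) * g (E.to i))    ≈⟨ sum-cong-≋ (λ i → g-* (E.to i)) ⟨
      ∏ (λ i → g (x * E.to i))             ≈⟨ sum-reindex *-commutativeMonoid g g-cong (x *_) (x⁻¹ *_) *-congˡ *-congˡ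
                                                (λ y → trans (sym (*-assoc x x⁻¹ y)) (trans (*-congʳ xx⁻¹≈1) (*-identityˡ y)))
                                                (λ y → trans (sym (*-assoc x⁻¹ x y)) (trans (*-congʳ (trans (*-comm x⁻¹ x) xx⁻¹≈1)) (*-identityˡ y))) ⟨
      ∏ (g ∘ E.to)                         ∎

  -- Without zero divisors, a factor p·1 that is nonzero can be cancelled from p^k·1 = 0; after k
  -- cancellations 1 = 0 would remain.
  p^k·1≈0⇒p·1≈0 : ∀ p k → (p ℕ.^ k) · 1# ≈ 0# → p · 1# ≈ 0#
  p^k·1≈0⇒p·1≈0 p zero    1·1≈0 = contradiction (trans (sym (×-homo-1 1#)) 1·1≈0) 1≉0
  p^k·1≈0⇒p·1≈0 p (suc k) eq with p · 1# ≟ 0#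
  ... | yes p·1≈0 = p·1≈0
  ... | no  p·1≉0 = p^k·1≈0⇒p·1≈0 p k (*-cancelˡ-≈0 p·1≉0 (trans (sym (×1-homo-* p (p ℕ.^ k))) eq))

  private
    1≈0 : ∀ {a b} x y → 1 ℕ.+ x ℕ.* a ≡ y ℕ.* b → a · 1# ≈ 0# → b · 1# ≈ 0# → 1# ≈ 0#
    1≈0 {a} {b} x y eq a≈0 b≈0 = begin
      1#                     ≈⟨ +-identityʳ 1# ⟨
      1# + 0#                ≈⟨ +-congˡ (∣⇒·≈0 commutativeSemiring a≈0 (divides x ≡.refl) 1#) ⟨
      1# + (x ℕ.* a) · 1#    ≡⟨ ≡.cong (_· 1#) eq ⟩
      (y ℕ.* b) · 1#         ≈⟨ ∣⇒·≈0 commutativeSemiring b≈0 (divides y ≡.refl) 1# ⟩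
      0#                     ∎

  -- By Bézout a multiple of n and a multiple of q differ by 1, and q·1 = 0. It is applied to n = ℓ.
  coprime⇒n·1≉0 : ∀ {n} → Coprime n q → ¬ (n · 1# ≈ 0#)
  coprime⇒n·1≉0 {n} n⊥q n·1≈0 with coprime-Bézout n⊥q
  ... | Bézout.+- x y 1+yq≡xn = 1≉0 (1≈0 y x 1+yq≡xn q·1≈0 n·1≈0)
  ... | Bézout.-+ x y 1+xn≡yq = 1≉0 (1≈0 x y 1+xn≡yq n·1≈0 q·1≈0)

  avoid-two : ∀ {n} → 3 ≤ n → (i j : Fin n) → ∃ λ k → k ≢ i × k ≢ j
  avoid-two (s≤s (s≤s (s≤s _))) zero          zero          = suc zero , (λ ()) , (λ ())
  avoid-two (s≤s (s≤s (s≤s _))) zero          (suc zero)    = suc (suc zero) , (λ ()) , (λ ())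
  avoid-two (s≤s (s≤s (s≤s _))) zero          (suc (suc _)) = suc zero , (λ ()) , (λ ())
  avoid-two (s≤s (s≤s (s≤s _))) (suc zero)    zero          = suc (suc zero) , (λ ()) , (λ ())
  avoid-two (s≤s (s≤s (s≤s _))) (suc (suc _)) zero          = suc zero , (λ ()) , (λ ())
  avoid-two (s≤s (s≤s (s≤s _))) (suc _)       (suc _)       = zero , (λ ()) , (λ ())

  third-element : 3 ≤ q → ∀ x y → ∃ λ z → ¬ (z ≈ x) × ¬ (z ≈ y)
  third-element 3≤q x y with k , k≢x , k≢y ← avoid-two 3≤q (E.from x) (E.from y) =
    E.to k , (λ eq → k≢x (≡.sym (E.inverseʳ (sym eq)))) , (λ eq → k≢y (≡.sym (E.inverseʳ (sym eq))))

-- The ring F[X]/(Xⁿ - 1), acting on periodic functions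

module GroupRing {q : ℕ} (F : FiniteField q) where
  open FiniteField F hiding (zero)
  open FieldProperties F
  open Exp semiring
  open Mult semiring renaming (_×_ to _·_)
  open Sum semiring
  open SetoidReasoning setoid
  open CommutativeSemigroupProperties (CommutativeMonoid.commutativeSemigroup +-commutativeMonoid) using () renaming (interchange to +-interchange)

  -- Functions on ℤ/n are kept on ℕ: exponents are added and multiplied without reduction, and
  -- different moduli share one domain.
  Periodic : ℕ → (ℕ → Carrier) → Set
  Periodic n g = ∀ k → g (k ℕ.+ n) ≈ g k

  shift : ℕ → (ℕ → Carrier) → ℕ → Carrier
  shift i g k = g (i ℕ.+ k)

  periodic-mod : ∀ {n g} → Periodic n g → ∀ {a b} → a ≡ b [mod n ] → g a ≈ g b
  periodic-mod {n} {g} per {a} {b} (x , y , eq) = begin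
    g a                 ≈⟨ multiple x ⟨
    g (a ℕ.+ x ℕ.* n)   ≡⟨ ≡.cong g eq ⟩
    g (b ℕ.+ y ℕ.* n)   ≈⟨ multiple y ⟩
    g b                 ∎
    where
    multiple : ∀ x {k} → g (k ℕ.+ x ℕ.* n) ≈ g k
    multiple zero    {k} = reflexive (≡.cong g (ℕₚ.+-identityʳ k))
    multiple (suc x) {k} = begin
      g (k ℕ.+ (n ℕ.+ x ℕ.* n))  ≡⟨ ≡.cong g (≡.sym (ℕₚ.+-assoc k n (x ℕ.* n))) ⟩
      g (k ℕ.+ n ℕ.+ x ℕ.* n)    ≈⟨ multiple x ⟩
      g (k ℕ.+ n)                ≈⟨ per k ⟩
      g k                        ∎

  periodic-shift : ∀ {n g} i → Periodic n g → Periodic n (shift i g)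
  periodic-shift {n} {g} i per k = trans (reflexive (≡.cong g (≡.sym (ℕₚ.+-assoc i k n)))) (per (i ℕ.+ k))

  periodic-∙+ : ∀ {n g} → Periodic n g → ∀ l → Periodic n (λ k → g (k ℕ.+ l))
  periodic-∙+ {n} {g} per l k = trans (reflexive (≡.cong g (xy∙z≈xz∙y k n l))) (per (k ℕ.+ l))
    where open CommutativeSemigroupProperties ℕₚ.+-commutativeSemigroup using (xy∙z≈xz∙y)

  periodic-∘* : ∀ {n g} m → Periodic n g → Periodic n (λ k → g (m ℕ.* k))
  periodic-∘* {n} m per k = periodic-mod per (mod-*ˡ m (0 , 1 , ≡.trans (ℕₚ.+-identityʳ _) (≡.cong (k ℕ.+_) (≡.sym (ℕₚ.*-identityˡ n)))))

  periodic-*ˡ : ∀ {n g} m → Periodic n g → Periodic (m ℕ.* n) g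
  periodic-*ˡ {n} m per k = periodic-mod per (0 , m , ℕₚ.+-identityʳ _)

  -- The list r of pairs (a , k) stands for the polynomial Σ a Xᵏ.  Its class modulo Xⁿ - 1 is
  -- determined by the values ∫ r g = Σ a g(k) on the functions g of period n.
  Poly : Set
  Poly = List (Carrier × ℕ)

  ∫ : Poly → (ℕ → Carrier) → Carrier
  ∫ []            g = 0#
  ∫ ((a , k) ∷ r) g = a * g k + ∫ r g

  ∫-cong : ∀ r {g h} → (∀ k → g k ≈ h k) → ∫ r g ≈ ∫ r h
  ∫-cong []            g≈h = refl
  ∫-cong ((a , k) ∷ r) g≈h = +-cong (*-congˡ (g≈h k)) (∫-cong r g≈h)

  ∫-++ : ∀ r s g → ∫ (r ++ s) g ≈ ∫ r g + ∫ s g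
  ∫-++ []            s g = sym (+-identityˡ _)
  ∫-++ ((a , k) ∷ r) s g = trans (+-congˡ (∫-++ r s g)) (sym (+-assoc _ _ _))

  ∫-0 : ∀ r → ∫ r (λ _ → 0#) ≈ 0#
  ∫-0 []            = refl
  ∫-0 ((a , k) ∷ r) = trans (+-cong (zeroʳ a) (∫-0 r)) (+-identityˡ 0#)

  ∫-+ : ∀ r g h → ∫ r (λ k → g k + h k) ≈ ∫ r g + ∫ r h
  ∫-+ []            g h = sym (+-identityˡ 0#)
  ∫-+ ((a , k) ∷ r) g h = trans (+-cong (distribˡ a (g k) (h k)) (∫-+ r g h)) (+-interchange _ _ _ _)

  ∫-*ˡ : ∀ r a g → ∫ r (λ k → a * g k) ≈ a * ∫ r g
  ∫-*ˡ []            a g = sym (zeroʳ a)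
  ∫-*ˡ ((b , k) ∷ r) a g = begin
    b * (a * g k) + ∫ r (λ k → a * g k)  ≈⟨ +-cong (x∙yz≈y∙xz b a (g k)) (∫-*ˡ r a g) ⟩
    a * (b * g k) + a * ∫ r g            ≈⟨ distribˡ a _ _ ⟨
    a * (b * g k + ∫ r g)                ∎
    where open CommutativeSemigroupProperties (CommutativeMonoid.commutativeSemigroup *-commutativeMonoid) using (x∙yz≈y∙xz)

  ∫-sum : ∀ r {n} (g : Fin n → ℕ → Carrier) → ∫ r (λ k → ∑[ i < n ] g i k) ≈ ∑[ i < n ] ∫ r (g i)
  ∫-sum r {zero}  g = ∫-0 r
  ∫-sum r {suc n} g = trans (∫-+ r (g zero) _) (+-congˡ (∫-sum r (g ∘ suc)))

  ∫-periodic : ∀ {n} r (g : ℕ → ℕ → Carrier) → (∀ l → Periodic n (λ k → g k l)) → Periodic n (λ k → ∫ r (g k))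
  ∫-periodic r g per k = ∫-cong r (λ l → per l k)

  ∫-swap : ∀ r s (g : ℕ → ℕ → Carrier) → ∫ r (λ k → ∫ s (g k)) ≈ ∫ s (λ l → ∫ r (λ k → g k l))
  ∫-swap []            s g = sym (∫-0 s)
  ∫-swap ((a , k) ∷ r) s g = begin
    a * ∫ s (g k) + ∫ r (λ k → ∫ s (g k))                       ≈⟨ +-cong (sym (∫-*ˡ s a (g k))) (∫-swap r s g) ⟩
    ∫ s (λ l → a * g k l) + ∫ s (λ l → ∫ r (λ k → g k l))       ≈⟨ ∫-+ s _ _ ⟨
    ∫ s (λ l → a * g k l + ∫ r (λ k → g k l))                   ∎

  monomial* : Carrier → ℕ → Poly → Poly
  monomial* a k = map (λ (b , l) → a * b , k ℕ.+ l)

  infixl 7 _⊛_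
  _⊛_ : Poly → Poly → Poly
  []            ⊛ s = []
  ((a , k) ∷ r) ⊛ s = monomial* a k s ++ r ⊛ s

  ∫-monomial* : ∀ a k s g → ∫ (monomial* a k s) g ≈ a * ∫ s (shift k g)
  ∫-monomial* a k []            g = sym (zeroʳ a)
  ∫-monomial* a k ((b , l) ∷ s) g = begin
    a * b * g (k ℕ.+ l) + ∫ (monomial* a k s) g       ≈⟨ +-cong (*-assoc a b _) (∫-monomial* a k s g) ⟩
    a * (b * g (k ℕ.+ l)) + a * ∫ s (shift k g)       ≈⟨ distribˡ a _ _ ⟨
    a * (b * g (k ℕ.+ l) + ∫ s (shift k g))           ∎

  -- This is the module structure: the second factor sends `g` to `i ↦ ∫ s (shift i g)`. The
  -- multiplicative ring laws thereby become statements about iterated pairings, commutativity being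
  -- `∫-swap`.
  ∫-⊛ : ∀ r s g → ∫ (r ⊛ s) g ≈ ∫ r (λ k → ∫ s (shift k g))
  ∫-⊛ []            s g = refl
  ∫-⊛ ((a , k) ∷ r) s g = trans (∫-++ (monomial* a k s) (r ⊛ s) g) (+-cong (∫-monomial* a k s g) (∫-⊛ r s g))

  𝟙 : Poly
  𝟙 = (1# , 0) ∷ []

  ∫-𝟙 : ∀ g → ∫ 𝟙 g ≈ g 0
  ∫-𝟙 g = trans (+-identityʳ _) (*-identityˡ _)

  ∫-⊛-comm : ∀ r s g → ∫ (r ⊛ s) g ≈ ∫ (s ⊛ r) g
  ∫-⊛-comm r s g = begin
    ∫ (r ⊛ s) g                           ≈⟨ ∫-⊛ r s g ⟩
    ∫ r (λ k → ∫ s (λ l → g (k ℕ.+ l)))   ≈⟨ ∫-swap r s (λ k l → g (k ℕ.+ l)) ⟩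
    ∫ s (λ l → ∫ r (λ k → g (k ℕ.+ l)))   ≈⟨ ∫-cong s (λ l → ∫-cong r (λ k → reflexive (≡.cong g (ℕₚ.+-comm k l)))) ⟩
    ∫ s (λ l → ∫ r (λ k → g (l ℕ.+ k)))   ≈⟨ ∫-⊛ s r g ⟨
    ∫ (s ⊛ r) g                           ∎

  ∫-⊛-assoc : ∀ r s u g → ∫ ((r ⊛ s) ⊛ u) g ≈ ∫ (r ⊛ (s ⊛ u)) g
  ∫-⊛-assoc r s u g = begin
    ∫ ((r ⊛ s) ⊛ u) g                                 ≈⟨ ∫-⊛ (r ⊛ s) u g ⟩
    ∫ (r ⊛ s) (λ k → ∫ u (shift k g))                 ≈⟨ ∫-⊛ r s _ ⟩
    ∫ r (λ i → ∫ s (λ j → ∫ u (shift (i ℕ.+ j) g)))   ≈⟨ ∫-cong r (λ i → ∫-cong s (λ j → ∫-cong u (λ k → reflexive (≡.cong g (ℕₚ.+-assoc i j k))))) ⟩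
    ∫ r (λ i → ∫ s (λ j → ∫ u (shift j (shift i g)))) ≈⟨ ∫-cong r (λ i → ∫-⊛ s u (shift i g)) ⟨
    ∫ r (λ i → ∫ (s ⊛ u) (shift i g))                 ≈⟨ ∫-⊛ r (s ⊛ u) g ⟨
    ∫ (r ⊛ (s ⊛ u)) g                                 ∎

  infix 4 _≋_[period_]
  _≋_[period_] : Poly → Poly → ℕ → Set
  r ≋ s [period n ] = ∀ g → Periodic n g → ∫ r g ≈ ∫ s g

  -- By `frobenius` this is the equation r^q = r. In terms of exponents it gives the symmetry of the
  -- coefficients, and it passes at once from n to any divisor of n.
  Invariant : ℕ → Poly → Set
  Invariant n r = ∀ g → Periodic n g → ∫ r (λ k → g (q ℕ.* k)) ≈ ∫ r g

  groupRing : ℕ → CommutativeSemiring 0ℓ 0ℓ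
  groupRing n = record
    { Carrier = Poly
    ; _≈_ = λ r s → r ≋ s [period n ]
    ; _+_ = _++_
    ; _*_ = _⊛_
    ; 0# = []
    ; 1# = 𝟙
    ; isCommutativeSemiring = isCommutativeSemiringˡ record
      { +-isCommutativeMonoid = isCommutativeMonoidˡ record
        { isSemigroup = record
          { isMagma = record
            { isEquivalence = isEquivalence-≋
            ; ∙-cong = λ {r} {r′} {s} {s′} r≋r′ s≋s′ g per →
                trans (∫-++ r s g) (trans (+-cong (r≋r′ g per) (s≋s′ g per)) (sym (∫-++ r′ s′ g)))
            }
          ; assoc = λ r s u g _ → begin
              ∫ ((r ++ s) ++ u) g       ≈⟨ trans (∫-++ (r ++ s) u g) (+-congʳ (∫-++ r s g)) ⟩
              ∫ r g + ∫ s g + ∫ u g     ≈⟨ +-assoc _ _ _ ⟩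
              ∫ r g + (∫ s g + ∫ u g)   ≈⟨ trans (∫-++ r (s ++ u) g) (+-congˡ (∫-++ s u g)) ⟨
              ∫ (r ++ s ++ u) g         ∎
          }
        ; identityˡ = λ _ _ _ → refl
        ; comm = λ r s g _ → trans (∫-++ r s g) (trans (+-comm _ _) (sym (∫-++ s r g)))
        }
      ; *-isCommutativeMonoid = isCommutativeMonoidˡ record
        { isSemigroup = record
          { isMagma = record
            { isEquivalence = isEquivalence-≋
            ; ∙-cong = λ {r} {r′} {s} {s′} r≋r′ s≋s′ g per → begin
                ∫ (r ⊛ s) g                     ≈⟨ ∫-⊛ r s g ⟩
                ∫ r (λ k → ∫ s (shift k g))     ≈⟨ ∫-cong r (λ k → s≋s′ (shift k g) (periodic-shift {g = g} k per)) ⟩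
                ∫ r (λ k → ∫ s′ (shift k g))    ≈⟨ r≋r′ _ (λ k → ∫-cong s′ (λ l → periodic-∙+ {g = g} per l k)) ⟩
                ∫ r′ (λ k → ∫ s′ (shift k g))   ≈⟨ ∫-⊛ r′ s′ g ⟨
                ∫ (r′ ⊛ s′) g                   ∎
            }
          ; assoc = λ r s u g _ → ∫-⊛-assoc r s u g
          }
        ; identityˡ = λ r g _ → trans (∫-⊛ 𝟙 r g) (∫-𝟙 (λ k → ∫ r (shift k g)))
        ; comm = λ r s g _ → ∫-⊛-comm r s g
        }
      ; distribʳ = λ r s u g _ → begin
          ∫ ((s ++ u) ⊛ r) g             ≈⟨ ∫-⊛ (s ++ u) r g ⟩
          ∫ (s ++ u) (λ k → ∫ r (shift k g)) ≈⟨ ∫-++ s u _ ⟩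
          ∫ s (λ k → ∫ r (shift k g)) + ∫ u (λ k → ∫ r (shift k g)) ≈⟨ +-cong (∫-⊛ s r g) (∫-⊛ u r g) ⟨
          ∫ (s ⊛ r) g + ∫ (u ⊛ r) g      ≈⟨ ∫-++ (s ⊛ r) (u ⊛ r) g ⟨
          ∫ (s ⊛ r ++ u ⊛ r) g           ∎
      ; zeroˡ = λ _ _ _ → refl
      }
    }
    where
    isEquivalence-≋ : IsEquivalence (λ r s → r ≋ s [period n ])
    isEquivalence-≋ = record
      { refl  = λ _ _ → refl
      ; sym   = λ r≋s g per → sym (r≋s g per)
      ; trans = λ r≋s s≋u g per → trans (r≋s g per) (s≋u g per)
      }

  module _ {n : ℕ} where
    private module R = CommutativeSemiring (groupRing n)
    open Exp R.semiring using () renaming (_^_ to _⋆_; ^-congˡ to ⋆-congˡ; ^-assocʳ to ⋆-assocʳ)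
    open Mult R.semiring using () renaming (_×_ to _·ᴿ_)

    ∫-· : ∀ m r g → ∫ (m ·ᴿ r) g ≈ m · ∫ r g
    ∫-· zero    r g = refl
    ∫-· (suc m) r g = trans (∫-++ r (m ·ᴿ r) g) (+-congˡ (∫-· m r g))

    ∫-monomial-⋆ : ∀ a k m g → ∫ (((a , k) ∷ []) ⋆ m) g ≈ a ^ m * g (m ℕ.* k)
    ∫-monomial-⋆ a k zero    g = +-identityʳ _
    ∫-monomial-⋆ a k (suc m) g = begin
      ∫ (((a , k) ∷ []) ⊛ P) g             ≈⟨ ∫-⊛ ((a , k) ∷ []) P g ⟩
      a * ∫ P (shift k g) + 0#             ≈⟨ +-identityʳ _ ⟩
      a * ∫ P (shift k g)                  ≈⟨ *-congˡ (∫-monomial-⋆ a k m (shift k g)) ⟩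
      a * (a ^ m * g (k ℕ.+ m ℕ.* k))      ≈⟨ *-assoc a _ _ ⟨
      a * a ^ m * g (k ℕ.+ m ℕ.* k)        ∎
      where P = ((a , k) ∷ []) ⋆ m

    module _ {p k} (p-prime : Prime p) (q≡p^k : q ≡ p ℕ.^ k) where

      -- Taking q-th powers is additive in characteristic p, and a monomial has (aXⁱ)^q = a^q X^(qi)
      -- with a^q = a. For the empty polynomial q > 0 matters, and the index of `0#` in `Fin q`
      -- attests it.
      frobenius : ∀ r g → Periodic n g → ∫ (r ⋆ q) g ≈ ∫ r (λ i → g (q ℕ.* i))
      frobenius []            g per = 0⋆q (Inverse.from enum 0#)
        where
        0⋆q : ∀ {m} → Fin m → ∫ ([] ⋆ m) g ≈ 0#
        0⋆q {suc m} _ = refl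
      frobenius ((a , i) ∷ r) g per = begin
        ∫ (((a , i) ∷ r) ⋆ q) g                          ≡⟨ ≡.cong (λ m → ∫ (((a , i) ∷ r) ⋆ m) g) q≡p^k ⟩
        ∫ (((a , i) ∷ r) ⋆ p ℕ.^ k) g                    ≈⟨ ^p^k-distrib-+ (groupRing n) p-prime p·𝟙≋0 k ((a , i) ∷ []) r g per ⟩
        ∫ (((a , i) ∷ []) ⋆ p ℕ.^ k ++ r ⋆ p ℕ.^ k) g    ≡⟨ ≡.cong (λ m → ∫ (((a , i) ∷ []) ⋆ m ++ r ⋆ m) g) (≡.sym q≡p^k) ⟩
        ∫ (((a , i) ∷ []) ⋆ q ++ r ⋆ q) g                ≈⟨ ∫-++ (((a , i) ∷ []) ⋆ q) (r ⋆ q) g ⟩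
        ∫ (((a , i) ∷ []) ⋆ q) g + ∫ (r ⋆ q) g           ≈⟨ +-cong (trans (∫-monomial-⋆ a i q g) (*-congʳ (x^q≈x a))) (frobenius r g per) ⟩
        a * g (q ℕ.* i) + ∫ r (λ i → g (q ℕ.* i))        ∎
        where
        p·1≈0 : p · 1# ≈ 0#
        p·1≈0 = p^k·1≈0⇒p·1≈0 p k (≡.subst (λ m → m · 1# ≈ 0#) q≡p^k q·1≈0)

        p·𝟙≋0 : (p ·ᴿ 𝟙) ≋ [] [period n ]
        p·𝟙≋0 g _ = trans (∫-· p 𝟙 g) (∣⇒·≈0 commutativeSemiring {p} p·1≈0 ∣-refl (∫ 𝟙 g))

      frobenius-iterate : ∀ m r g → Periodic n g → ∫ (r ⋆ (q ℕ.^ m)) g ≈ ∫ r (λ i → g (q ℕ.^ m ℕ.* i))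
      frobenius-iterate zero    r g per = trans (R.*-identityʳ r g per) (∫-cong r (λ i → reflexive (≡.cong g (≡.sym (ℕₚ.*-identityˡ i)))))
      frobenius-iterate (suc m) r g per = begin
        ∫ (r ⋆ (q ℕ.* Q)) g                   ≈⟨ ⋆-assocʳ r q Q g per ⟨
        ∫ ((r ⋆ q) ⋆ Q) g                     ≈⟨ frobenius-iterate m (r ⋆ q) g per ⟩
        ∫ (r ⋆ q) (λ i → g (Q ℕ.* i))         ≈⟨ frobenius r _ (periodic-∘* {g = g} Q per) ⟩
        ∫ r (λ i → g (Q ℕ.* (q ℕ.* i)))       ≈⟨ ∫-cong r (λ i → reflexive (≡.cong g (≡.trans (≡.sym (ℕₚ.*-assoc Q q i)) (≡.cong (ℕ._* i) (ℕₚ.*-comm Q q))))) ⟩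
        ∫ r (λ i → g (q ℕ.* Q ℕ.* i))         ∎
        where Q = q ℕ.^ m

      -- If q ^ f ≡ 1 modulo n then w ^ (q ^ f) = w, so w divides the idempotent w ^ (q ^ f - 1).
      invariant-multiple : ∀ {m f} → q ℕ.^ f ≡ 2 ℕ.+ m → q ℕ.^ f ≡ 1 [mod n ] → ∀ w →
        ∃ λ s → Invariant n (w ⊛ s) × ((w ⊛ s) ⊛ w) ≋ w [period n ]
      -- With q^f = 2 + m the idempotent is w^(1+m), which is by definition `w ⊛ (w ⋆ m)`: the
      -- cofactor is w^m, and w^(1+m) w = w^(2+m) = w.
      invariant-multiple {m} {f} q^f≡2+m q^f≡1 w = w ⋆ m , invariant , λ g per → trans (∫-⊛-comm (w ⋆ suc m) w g) (w^[2+m]≋w g per)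
        where
        w^[2+m]≋w : (w ⋆ (2 ℕ.+ m)) ≋ w [period n ]
        w^[2+m]≋w g per = begin
          ∫ (w ⋆ (2 ℕ.+ m)) g                ≡⟨ ≡.cong (λ N → ∫ (w ⋆ N) g) (≡.sym q^f≡2+m) ⟩
          ∫ (w ⋆ (q ℕ.^ f)) g                ≈⟨ frobenius-iterate f w g per ⟩
          ∫ w (λ i → g (q ℕ.^ f ℕ.* i))      ≈⟨ ∫-cong w (λ i → periodic-mod {g = g} per
                                                  (≡.subst₂ (λ a b → a ≡ b [mod n ]) (ℕₚ.*-comm i (q ℕ.^ f)) (ℕₚ.*-identityʳ i) (mod-*ˡ i q^f≡1))) ⟩
          ∫ w g                              ∎

        e⋆q≋e : ∀ {j} → Fin j → ((w ⋆ suc m) ⋆ j) ≋ w ⋆ suc m [period n ]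
        e⋆q≋e {suc j} _ = idempotent-^ (groupRing n) {w ⋆ suc m} (w^[1+m]≈w⇒w^m-idempotent (groupRing n) w (suc m) w^[2+m]≋w) j

        invariant : Invariant n (w ⋆ suc m)
        invariant g per = trans (sym (frobenius (w ⋆ suc m) g per)) (e⋆q≋e (Inverse.from enum 0#) g per)

-- Sums over a period, and coefficients modulo Xⁿ - 1

module PeriodicSums {q : ℕ} (F : FiniteField q) where
  open FiniteField F hiding (zero)
  open GroupRing F
  open Sum semiring
  open GroupProperties +-group using () renaming (∙-cancelʳ to +-cancelʳ)
  open SetoidReasoning setoid

  Σ< : ℕ → (ℕ → Carrier) → Carrier
  Σ< n g = sum {n} (g ∘ toℕ)

  Σ<-cong : ∀ n {g h} → (∀ k → k < n → g k ≈ h k) → Σ< n g ≈ Σ< n h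
  Σ<-cong n g≈h = sum-cong-≋ {n} (λ i → g≈h (toℕ i) (toℕ<n i))

  Σ<-0 : ∀ n {g} → (∀ k → k < n → g k ≈ 0#) → Σ< n g ≈ 0#
  Σ<-0 n g≈0 = trans (Σ<-cong n g≈0) (sum-replicate-zero n)

  Σ<-*ˡ : ∀ n a g → Σ< n (λ k → a * g k) ≈ a * Σ< n g
  Σ<-*ˡ n a g = sym (*-distribˡ-sum {n} a (g ∘ toℕ))

  Σ<-+ : ∀ m n g → Σ< (m ℕ.+ n) g ≈ Σ< m g + Σ< n (shift m g)
  Σ<-+ zero    n g = sym (+-identityˡ _)
  Σ<-+ (suc m) n g = trans (+-congˡ (Σ<-+ m n (g ∘ suc))) (sym (+-assoc _ _ _))

  Σ<-* : ∀ m n g → Σ< (m ℕ.* n) g ≈ Σ< n (λ j → Σ< m (λ s → g (s ℕ.* n ℕ.+ j)))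
  Σ<-* m n g = trans (blocks m g) (∑-comm {m} {n} _)
    where
    blocks : ∀ m g → Σ< (m ℕ.* n) g ≈ Σ< m (λ s → Σ< n (λ j → g (s ℕ.* n ℕ.+ j)))
    blocks zero    g = refl
    blocks (suc m) g = trans (Σ<-+ n (m ℕ.* n) g) (+-congˡ (trans (blocks m (shift n g))
      (Σ<-cong m (λ s _ → Σ<-cong n (λ j _ → reflexive (≡.cong g (≡.sym (ℕₚ.+-assoc n (s ℕ.* n) j))))))))

  -- A shift by one trades the summand g(0) for g(n), which equals it; both sides are compared after
  -- adding g(0).
  Σ<-rotate : ∀ n {g} → Periodic n g → ∀ m → Σ< n (shift m g) ≈ Σ< n g
  Σ<-rotate n     per zero    = refl
  Σ<-rotate n {g} per (suc m) = trans (Σ<-rotate n (per ∘ suc) m) (+-cancelʳ (g 0) _ _ (begin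
    Σ< n (g ∘ suc) + g 0            ≈⟨ +-comm _ _ ⟩
    Σ< (1 ℕ.+ n) g                  ≡⟨ ≡.cong (λ k → Σ< k g) (ℕₚ.+-comm 1 n) ⟩
    Σ< (n ℕ.+ 1) g                  ≈⟨ Σ<-+ n 1 g ⟩
    Σ< n g + (g (n ℕ.+ 0) + 0#)     ≈⟨ +-congˡ (+-identityʳ _) ⟩
    Σ< n g + g (n ℕ.+ 0)            ≈⟨ +-congˡ (trans (reflexive (≡.cong g (ℕₚ.+-identityʳ n))) (per 0)) ⟩
    Σ< n g + g 0                    ∎))

  sum-pick : ∀ {n} (i : Fin n) f → (∀ j → j ≢ i → f j ≈ 0#) → sum f ≈ f i
  sum-pick {suc n} zero    f f≈0 = trans (+-congˡ (sum≈0 commutativeSemiring (f ∘ suc) (λ j → f≈0 (suc j) (λ ())))) (+-identityʳ _)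
  sum-pick {suc n} (suc i) f f≈0 = trans
    (+-cong (f≈0 zero (λ ())) (sum-pick i (f ∘ suc) (λ j j≢i → f≈0 (suc j) (j≢i ∘ suc-injective))))
    (+-identityˡ _)

  -- The pushforward of functions along ℤ/mh → ℤ/h, that is, summation over the cosets of hℤ.
  fold : ℕ → ℕ → (ℕ → Carrier) → ℕ → Carrier
  fold m h g j = Σ< m (λ s → g (s ℕ.* h ℕ.+ j))

  -- Moving j by h only rotates the m summands, since g repeats after m steps of length h.
  fold-periodic : ∀ m h {g} → Periodic (m ℕ.* h) g → Periodic h (fold m h g)
  fold-periodic m h {g} per j = begin
    Σ< m (λ s → g (s ℕ.* h ℕ.+ (j ℕ.+ h)))  ≈⟨ Σ<-cong m (λ s _ → reflexive (≡.cong g (solve 3 (λ a j h → a :+ (j :+ h) := (h :+ a) :+ j) ≡.refl (s ℕ.* h) j h))) ⟩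
    Σ< m (shift 1 G)                        ≈⟨ Σ<-rotate m G-periodic 1 ⟩
    Σ< m G                                  ∎
    where
    open +-*-Solver
    G : ℕ → Carrier
    G s = g (s ℕ.* h ℕ.+ j)

    G-periodic : Periodic m G
    G-periodic s = trans (reflexive (≡.cong g (solve 4 (λ s m h j → (s :+ m) :* h :+ j := (s :* h :+ j) :+ m :* h) ≡.refl s m h j)))
                         (per (s ℕ.* h ℕ.+ j))

  -- Such a c is h-periodic up to the correction c 0 - c h at 0.
  Σ<-fold : ∀ m h .{{_ : NonZero m}} .{{_ : NonZero h}} (c : ℕ → Carrier) →
            (∀ s j → 0 < j → j < h → c (s ℕ.* h ℕ.+ j) ≈ c j) →
            (∀ s → 0 < s → s < m → c (s ℕ.* h) ≈ c h) →
            ∃ λ (c′ : ℕ → Carrier) → ∀ g → Σ< (m ℕ.* h) (λ k → c k * g k) ≈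
                           Σ< h (λ j → c′ j * fold m h g j) + (c 0 - c h) * g 0
  Σ<-fold (suc m) (suc h) c c-class c-multiple = c′ , λ g → let open Proof g in begin
    Σ< (suc m ℕ.* suc h) (λ k → c k * g k)     ≈⟨ Σ<-* (suc m) (suc h) (λ k → c k * g k) ⟩
    column 0 + Σ< h (column ∘ suc)             ≈⟨ +-cong column-0 (Σ<-cong h (λ j j<h → column-suc j j<h)) ⟩
    c (suc h) * fold (suc m) (suc h) g 0 + D * g 0 + Σ< h (λ j → c (suc j) * fold (suc m) (suc h) g (suc j))
                                               ≈⟨ xy∙z≈xz∙y _ _ _ ⟩
    Σ< (suc h) (λ j → c′ j * fold (suc m) (suc h) g j) + D * g 0 ∎
    where
    open CommutativeSemigroupProperties (CommutativeMonoid.commutativeSemigroup +-commutativeMonoid) using (xy∙z≈xz∙y)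

    c′ : ℕ → Carrier
    c′ zero    = c (suc h)
    c′ (suc j) = c (suc j)

    D : Carrier
    D = c 0 - c (suc h)

    module Proof (g : ℕ → Carrier) where
      column : ℕ → Carrier
      column j = Σ< (suc m) (λ s → c (s ℕ.* suc h ℕ.+ j) * g (s ℕ.* suc h ℕ.+ j))

      column-suc : ∀ j → j < h → column (suc j) ≈ c (suc j) * fold (suc m) (suc h) g (suc j)
      column-suc j j<h = trans (Σ<-cong (suc m) (λ s _ → *-congʳ {x = g (s ℕ.* suc h ℕ.+ suc j)} (c-class s (suc j) (s≤s z≤n) (s≤s j<h))))
                               (Σ<-*ˡ (suc m) (c (suc j)) (λ s → g (s ℕ.* suc h ℕ.+ suc j)))

      rest : Carrier
      rest = Σ< m (λ s → g (suc s ℕ.* suc h ℕ.+ 0))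

      column-0 : column 0 ≈ c (suc h) * fold (suc m) (suc h) g 0 + D * g 0
      column-0 = begin
        c 0 * g 0 + Σ< m (λ s → c (suc s ℕ.* suc h ℕ.+ 0) * g (suc s ℕ.* suc h ℕ.+ 0))
          ≈⟨ +-congˡ (trans (Σ<-cong m (λ s s<m → *-congʳ {x = g (suc s ℕ.* suc h ℕ.+ 0)} (trans (reflexive (≡.cong c (ℕₚ.+-identityʳ (suc s ℕ.* suc h)))) (c-multiple (suc s) (s≤s z≤n) (s≤s s<m)))))
                            (Σ<-*ˡ m (c (suc h)) (λ s → g (suc s ℕ.* suc h ℕ.+ 0)))) ⟩
        c 0 * g 0 + c (suc h) * rest
          ≈⟨ +-congʳ (*-congʳ c0≈D+ch) ⟩
        (D + c (suc h)) * g 0 + c (suc h) * rest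
          ≈⟨ +-congʳ (trans (distribʳ (g 0) D (c (suc h))) (+-comm _ _)) ⟩
        c (suc h) * g 0 + D * g 0 + c (suc h) * rest
          ≈⟨ xy∙z≈xz∙y _ _ _ ⟩
        c (suc h) * g 0 + c (suc h) * rest + D * g 0
          ≈⟨ +-congʳ (distribˡ (c (suc h)) (g 0) rest) ⟨
        c (suc h) * (g 0 + rest) + D * g 0 ∎
        where
        c0≈D+ch : c 0 ≈ D + c (suc h)
        c0≈D+ch = sym (trans (+-assoc _ _ _) (trans (+-congˡ (-‿inverseˡ _)) (+-identityʳ _)))

  module _ {n : ℕ} .{{_ : NonZero n}} where

    δ : ℕ → ℕ → Carrier
    δ k m with m % n ℕ.≟ k % n
    ... | yes _ = 1#
    ... | no  _ = 0#

    δ≈1 : ∀ {k m} → m % n ≡ k % n → δ k m ≈ 1#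
    δ≈1 {k} {m} eq with m % n ℕ.≟ k % n
    ... | yes _ = refl
    ... | no ne = contradiction eq ne

    δ≈0 : ∀ {k m} → m % n ≢ k % n → δ k m ≈ 0#
    δ≈0 {k} {m} ne with m % n ℕ.≟ k % n
    ... | yes eq = contradiction eq ne
    ... | no _   = refl

    δ-cong : ∀ {k m k′ m′} → (m % n ≡ k % n → m′ % n ≡ k′ % n) → (m′ % n ≡ k′ % n → m % n ≡ k % n) → δ k m ≈ δ k′ m′
    δ-cong {k} {m} f g with m % n ℕ.≟ k % n
    ... | yes eq = sym (δ≈1 (f eq))
    ... | no ne  = sym (δ≈0 (ne ∘ g))

    δ-periodic : ∀ k → Periodic n (δ k)
    δ-periodic k m = δ-cong (≡.trans (≡.sym ([m+n]%n≡m%n m n))) (≡.trans ([m+n]%n≡m%n m n))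

    coefficient : Poly → ℕ → Carrier
    coefficient e k = ∫ e (δ k)

    coefficient-mod : ∀ e {k k′} → k ≡ k′ [mod n ] → coefficient e k ≈ coefficient e k′
    coefficient-mod e k≡k′ = ∫-cong e (λ m → δ-cong (λ eq → ≡.trans eq (mod⇒% k≡k′)) (λ eq → ≡.trans eq (≡.sym (mod⇒% k≡k′))))

    -- A periodic g is the combination of the indicators δ k with weights g(k), k < n, and `∫ e` is
    -- linear.
    ∫≈Σ-coefficient : ∀ e {g} → Periodic n g → ∫ e g ≈ Σ< n (λ k → coefficient e k * g k)
    ∫≈Σ-coefficient e {g} per = begin
      ∫ e g                                              ≈⟨ ∫-cong e (λ m → sym (Σδg≈g m)) ⟩
      ∫ e (λ m → Σ< n (λ k → g k * δ k m))               ≈⟨ ∫-sum e {n} (λ i m → g (toℕ i) * δ (toℕ i) m) ⟩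
      Σ< n (λ k → ∫ e (λ m → g k * δ k m))               ≈⟨ Σ<-cong n (λ k _ → trans (∫-*ˡ e (g k) (δ k)) (*-comm _ _)) ⟩
      Σ< n (λ k → coefficient e k * g k)                 ∎
      where
      Σδg≈g : ∀ m → Σ< n (λ k → g k * δ k m) ≈ g m
      Σδg≈g m = begin
        Σ< n (λ k → g k * δ k m)        ≈⟨ sum-pick r (λ i → g (toℕ i) * δ (toℕ i) m) (λ i i≢r → trans (*-congˡ (δ≈0 (λ eq → i≢r (toℕ-injective
                                             (≡.trans (≡.sym (≡.trans eq (m<n⇒m%n≡m (toℕ<n i)))) (≡.sym toℕ-r)))))) (zeroʳ _)) ⟩
        g (toℕ r) * δ (toℕ r) m         ≡⟨ ≡.cong (λ k → g k * δ k m) toℕ-r ⟩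
        g (m % n) * δ (m % n) m         ≈⟨ *-congˡ (δ≈1 (≡.sym (m%n%n≡m%n m n))) ⟩
        g (m % n) * 1#                  ≈⟨ *-identityʳ _ ⟩
        g (m % n)                       ≈⟨ periodic-mod {g = g} per (%⇒mod (m%n%n≡m%n m n)) ⟩
        g m                             ∎
        where
        r : Fin n
        r = fromℕ< (m%n<n m n)

        toℕ-r : toℕ r ≡ m % n
        toℕ-r = toℕ-fromℕ< (m%n<n m n)

    -- Invariance is tested on δ (qk). As q is a unit modulo n, qm ≡ qk holds exactly when m ≡ k, so
    -- m ↦ δ (qk) (qm) is δ k.
    coefficient-q* : PrimitiveRoot q n → ∀ e → Invariant n e → ∀ k → coefficient e (q ℕ.* k) ≈ coefficient e k
    coefficient-q* q-root e inv k = begin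
      ∫ e (δ (q ℕ.* k))                       ≈⟨ inv _ (δ-periodic (q ℕ.* k)) ⟨
      ∫ e (λ m → δ (q ℕ.* k) (q ℕ.* m))       ≈⟨ ∫-cong e (λ m → δ-cong
                                                   (λ eq → mod⇒% (q-cancel q-root (%⇒mod eq)))
                                                   (λ eq → mod⇒% (mod-*ˡ q (%⇒mod {a = m} {b = k} eq)))) ⟩
      ∫ e (δ k)                               ∎

    coefficient-q^* : PrimitiveRoot q n → ∀ e → Invariant n e → ∀ i k → coefficient e (q ℕ.^ i ℕ.* k) ≈ coefficient e k
    coefficient-q^* q-root e inv zero    k = reflexive (≡.cong (coefficient e) (ℕₚ.*-identityˡ k))
    coefficient-q^* q-root e inv (suc i) k = begin
      coefficient e (q ℕ.* q ℕ.^ i ℕ.* k)      ≡⟨ ≡.cong (coefficient e) (ℕₚ.*-assoc q (q ℕ.^ i) k) ⟩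
      coefficient e (q ℕ.* (q ℕ.^ i ℕ.* k))    ≈⟨ coefficient-q* q-root e inv (q ℕ.^ i ℕ.* k) ⟩
      coefficient e (q ℕ.^ i ℕ.* k)            ≈⟨ coefficient-q^* q-root e inv i k ⟩
      coefficient e k                          ∎

  -- The first three terms, and every later pair, sum to zero.
  alternating : Carrier → ℕ → Carrier
  alternating a 0 = 1#
  alternating a 1 = a
  alternating a 2 = - (1# + a)
  alternating a 3 = 1#
  alternating a 4 = - 1#
  alternating a (suc (suc k@(suc (suc (suc _))))) = alternating a k

  -- Only the terms a and -(1 + a) depend on a, and the two hypotheses keep exactly these away from
  -- 0. A field with at least three elements contains such an a.
  alternating-≉0 : ∀ {a} → ¬ (a ≈ 0#) → ¬ (a ≈ - 1#) → ∀ k → ¬ (alternating a k ≈ 0#)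
  alternating-≉0 {a} a≉0 a≉-1 = go
    where
    open GroupProperties +-group using (inverseʳ-unique; ⁻¹-involutive; ε⁻¹≈ε)

    -x≈0⇒x≈0 : ∀ {x} → - x ≈ 0# → x ≈ 0#
    -x≈0⇒x≈0 {x} -x≈0 = trans (sym (⁻¹-involutive x)) (trans (-‿cong -x≈0) ε⁻¹≈ε)

    go : ∀ k → ¬ (alternating a k ≈ 0#)
    go 0 = 1≉0
    go 1 = a≉0
    go 2 = λ eq → a≉-1 (inverseʳ-unique 1# a (-x≈0⇒x≈0 eq))
    go 3 = 1≉0
    go 4 = λ eq → 1≉0 (-x≈0⇒x≈0 eq)
    go (suc (suc k@(suc (suc (suc _))))) = go k

  Σ<-alternating : ∀ a r → Σ< (3 ℕ.+ r ℕ.* 2) (alternating a) ≈ 0#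
  Σ<-alternating a r = begin
    1# + (a + (- (1# + a) + tail))    ≈⟨ +-congˡ (+-congˡ (trans (+-congˡ (tail≈0 r)) (+-identityʳ _))) ⟩
    1# + (a + - (1# + a))             ≈⟨ +-assoc _ _ _ ⟨
    1# + a + - (1# + a)               ≈⟨ -‿inverseʳ _ ⟩
    0#                                ∎
    where
    tail : Carrier
    tail = Σ< (r ℕ.* 2) (λ k → alternating a (3 ℕ.+ k))

    tail≈0 : ∀ r → Σ< (r ℕ.* 2) (λ k → alternating a (3 ℕ.+ k)) ≈ 0#
    tail≈0 zero    = refl
    tail≈0 (suc r) = trans (sym (+-assoc _ _ _)) (trans (+-cong (-‿inverseʳ 1#) (tail≈0 r)) (+-identityˡ 0#))

-- Nowhere zero multiples modulo X^(ℓ^t) - 1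

module NowhereZero {q : ℕ} (F : FiniteField q) (3≤q : 3 ≤ q) {ℓ : ℕ} (ℓ-prime : Prime ℓ) (ℓ≢2 : ℓ ≢ 2)
                   (q-root : ∀ t → 1 ≤ t → PrimitiveRoot q (ℓ ℕ.^ t)) where
  open FiniteField F hiding (zero)
  open FieldProperties F
  open GroupRing F
  open PeriodicSums F
  open Mult semiring renaming (_×_ to _·_)
  open Sum semiring
  open GroupProperties +-group using (x≈y⇒x∙y⁻¹≈ε; x∙y⁻¹≈ε⇒x≈y)
  open SetoidReasoning setoid

  private instance
    ℓ≢0 : NonZero ℓ
    ℓ≢0 = prime⇒nonZero ℓ-prime

  private
    ℓ^≢0 : ∀ t → NonZero (ℓ ℕ.^ t)
    ℓ^≢0 t = ℕₚ.m^n≢0 ℓ t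

    coeff : ℕ → Poly → ℕ → Carrier
    coeff t = coefficient {ℓ ℕ.^ t} {{ℓ^≢0 t}}

  -- Both `3 ≤ q` and the oddness of ℓ enter here. Over 𝔽₂ an odd number of nonzero elements has sum
  -- 1.
  nonvanishing-zero-sum : ∃ λ y → (∀ k → ¬ (y k ≈ 0#)) × Σ< ℓ y ≈ 0#
  nonvanishing-zero-sum with third-element 3≤q 0# (- 1#) | odd-prime≡3+2r ℓ-prime ℓ≢2
  ... | a , a≉0 , a≉-1 | r , ℓ≡3+2r = alternating a , alternating-≉0 a≉0 a≉-1 ,
    ≡.subst (λ m → Σ< m (alternating a) ≈ 0#) (≡.sym ℓ≡3+2r) (Σ<-alternating a r)

  -- Take g constant on blocks of length h, running through y from block to block. The points k, k +
  -- h, k + 2h, ... lie in consecutive blocks, so each coset sum is a rotation of the zero sum of y.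
  nonvanishing-fold≈0 : ∀ h .{{_ : NonZero h}} →
    ∃ λ g → Periodic (ℓ ℕ.* h) g × (∀ k → ¬ (g k ≈ 0#)) × (∀ k → fold ℓ h g k ≈ 0#)
  nonvanishing-fold≈0 h with y , y≉0 , Σy≈0 ← nonvanishing-zero-sum = g , g-periodic , (λ k → y≉0 (k / h % ℓ)) , fold≈0
    where
    Y g : ℕ → Carrier
    Y k = y (k % ℓ)
    g k = Y (k / h)

    Y-periodic : Periodic ℓ Y
    Y-periodic k = reflexive (≡.cong y ([m+n]%n≡m%n k ℓ))

    [sh+k]/h : ∀ s k → (s ℕ.* h ℕ.+ k) / h ≡ k / h ℕ.+ s
    [sh+k]/h s k = ≡.trans (+-distrib-/-∣ˡ k (n∣m*n s)) (≡.trans (≡.cong (ℕ._+ k / h) (m*n/n≡m s h)) (ℕₚ.+-comm s (k / h)))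

    g-periodic : Periodic (ℓ ℕ.* h) g
    g-periodic k = trans
      (reflexive (≡.cong Y (≡.trans (≡.cong (_/ h) (ℕₚ.+-comm k (ℓ ℕ.* h))) ([sh+k]/h ℓ k))))
      (Y-periodic (k / h))

    fold≈0 : ∀ k → fold ℓ h g k ≈ 0#
    fold≈0 k = begin
      Σ< ℓ (λ s → Y ((s ℕ.* h ℕ.+ k) / h))   ≈⟨ Σ<-cong ℓ (λ s _ → reflexive (≡.cong Y ([sh+k]/h s k))) ⟩
      Σ< ℓ (shift (k / h) Y)                 ≈⟨ Σ<-rotate ℓ Y-periodic (k / h) ⟩
      Σ< ℓ Y                                 ≈⟨ Σ<-cong ℓ (λ s s<ℓ → reflexive (≡.cong y (m<n⇒m%n≡m s<ℓ))) ⟩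
      Σ< ℓ y                                 ≈⟨ Σy≈0 ⟩
      0#                                     ∎

  -- The unit u is a power q^i modulo ℓ^(t-a), whence ℓᵃu ≡ q^i ℓᵃ modulo ℓᵗ, and the coefficients
  -- do not see the factor q^i.
  coefficient-ℓ-adic : ∀ {t e} → Invariant (ℓ ℕ.^ t) e → ∀ {a u} → a < t → ℓ ∤ u →
                       coeff t e (ℓ ℕ.^ a ℕ.* u) ≈ coeff t e (ℓ ℕ.^ a)
  coefficient-ℓ-adic {t} {e} inv {a} {u} a<t ℓ∤u
    with i , u≡q^i ← unit≡power {{ℓ^≢0 (t ℕ.∸ a)}} (q-root (t ℕ.∸ a) (ℕₚ.m<n⇒0<n∸m a<t)) (prime∤⇒coprime-^ ℓ-prime ℓ∤u (t ℕ.∸ a)) = begin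
    c (ℓ ℕ.^ a ℕ.* u)          ≈⟨ coefficient-mod {{ℓ^≢0 t}} e (≡.subst (λ n → _ ≡ _ [mod n ]) ℓ^aℓ^[t∸a] (mod-*-lift (ℓ ℕ.^ a) u≡q^i)) ⟩
    c (ℓ ℕ.^ a ℕ.* q ℕ.^ i)    ≡⟨ ≡.cong c (ℕₚ.*-comm (ℓ ℕ.^ a) (q ℕ.^ i)) ⟩
    c (q ℕ.^ i ℕ.* ℓ ℕ.^ a)    ≈⟨ coefficient-q^* {{ℓ^≢0 t}} (q-root t (ℕₚ.≤-<-trans z≤n a<t)) e inv i (ℓ ℕ.^ a) ⟩
    c (ℓ ℕ.^ a)                ∎
    where
    c : ℕ → Carrier
    c = coeff t e

    ℓ^aℓ^[t∸a] : ℓ ℕ.^ a ℕ.* ℓ ℕ.^ (t ℕ.∸ a) ≡ ℓ ℕ.^ t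
    ℓ^aℓ^[t∸a] = ≡.trans (≡.sym (ℕₚ.^-distribˡ-+-* ℓ a (t ℕ.∸ a))) (≡.cong (ℓ ℕ.^_) (ℕₚ.m+[n∸m]≡n (ℕₚ.<⇒≤ a<t)))

  -- Since 0 < j < ℓᵗ, the valuation of j is below t, and adding a multiple of ℓᵗ does not change
  -- it.
  coefficient-class : ∀ {t e} → Invariant (ℓ ℕ.^ suc t) e → ∀ s j → 0 < j → j < ℓ ℕ.^ t →
                      coeff (suc t) e (s ℕ.* ℓ ℕ.^ t ℕ.+ j) ≈ coeff (suc t) e j
  coefficient-class {t} {e} inv s j 0<j j<h with ℓ-adic ℓ-prime t 0<j j<h
  ... | a , u , a<t , ≡.refl , ℓ∤u = begin
    c (s ℕ.* ℓ ℕ.^ t ℕ.+ ℓ ℕ.^ a ℕ.* u)             ≡⟨ ≡.cong c factor ⟩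
    c (ℓ ℕ.^ a ℕ.* (s ℕ.* ℓ ℕ.^ (t ℕ.∸ a) ℕ.+ u))   ≈⟨ coefficient-ℓ-adic {suc t} {e} inv (ℕₚ.m<n⇒m<1+n a<t) (ℓ∤u ∘ λ ℓ∣ → ∣m+n∣m⇒∣n ℓ∣ ℓ∣sℓ^[t∸a]) ⟩
    c (ℓ ℕ.^ a)                                     ≈⟨ coefficient-ℓ-adic {suc t} {e} inv (ℕₚ.m<n⇒m<1+n a<t) ℓ∤u ⟨
    c (ℓ ℕ.^ a ℕ.* u)                               ∎
    where
    c : ℕ → Carrier
    c = coeff (suc t) e

    ℓ∣sℓ^[t∸a] : ℓ ∣ s ℕ.* ℓ ℕ.^ (t ℕ.∸ a)
    ℓ∣sℓ^[t∸a] with t ℕ.∸ a | ℕₚ.m<n⇒0<n∸m a<t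
    ... | suc b | _ = ∣-trans (m∣m*n (ℓ ℕ.^ b)) (n∣m*n s)

    factor : s ℕ.* ℓ ℕ.^ t ℕ.+ ℓ ℕ.^ a ℕ.* u ≡ ℓ ℕ.^ a ℕ.* (s ℕ.* ℓ ℕ.^ (t ℕ.∸ a) ℕ.+ u)
    factor = ≡.trans
      (≡.cong (λ n → s ℕ.* n ℕ.+ ℓ ℕ.^ a ℕ.* u)
        (≡.trans (≡.cong (ℓ ℕ.^_) (≡.sym (ℕₚ.m+[n∸m]≡n (ℕₚ.<⇒≤ a<t)))) (ℕₚ.^-distribˡ-+-* ℓ a (t ℕ.∸ a))))
      (solve 4 (λ s x y u → s :* (x :* y) :+ x :* u := x :* (s :* y :+ u)) ≡.refl s (ℓ ℕ.^ a) (ℓ ℕ.^ (t ℕ.∸ a)) u)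
      where open +-*-Solver

  -- All these exponents have valuation exactly t. Together with `coefficient-class` this supplies
  -- the hypotheses of `Σ<-fold`.
  coefficient-multiple : ∀ {t e} → Invariant (ℓ ℕ.^ suc t) e → ∀ s → 0 < s → s < ℓ →
                         coeff (suc t) e (s ℕ.* ℓ ℕ.^ t) ≈ coeff (suc t) e (ℓ ℕ.^ t)
  coefficient-multiple {t} {e} inv s@(suc _) _ s<ℓ = trans
    (reflexive (≡.cong (coeff (suc t) e) (ℕₚ.*-comm s (ℓ ℕ.^ t))))
    (coefficient-ℓ-adic {suc t} {e} inv (ℕₚ.n<1+n t) (λ ℓ∣s → ℕₚ.<⇒≱ s<ℓ (∣⇒≤ ℓ∣s)))

  ℓ·1≉0 : ¬ (ℓ · 1# ≈ 0#)
  ℓ·1≉0 = coprime⇒n·1≉0 (Coprimality.sym (≡.subst (Coprime q) (ℕₚ.*-identityʳ ℓ) (let q⊥ℓ , _ = q-root 1 (s≤s z≤n) in q⊥ℓ)))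

  fold-of-periodic : ∀ {h g} → Periodic h g → ∀ k → fold ℓ h g k ≈ ℓ · 1# * g k
  fold-of-periodic {h} {g} per k = begin
    Σ< ℓ (λ s → g (s ℕ.* h ℕ.+ k))   ≈⟨ Σ<-cong ℓ (λ s _ → trans (reflexive (≡.cong g (ℕₚ.+-comm (s ℕ.* h) k))) (periodic-mod {g = g} per (0 , s , ℕₚ.+-identityʳ _))) ⟩
    Σ< ℓ (λ _ → g k)                 ≈⟨ sum-replicate ℓ ⟩
    ℓ · g k                          ≈⟨ ×-congʳ ℓ (*-identityˡ (g k)) ⟨
    ℓ · (1# * g k)                   ≈⟨ ×-assoc-* ℓ 1# (g k) ⟨
    ℓ · 1# * g k                     ∎

  -- With h = ℓᵗ, this says e = e′ (1 + X^h + ... + X^((ℓ-1)h)) + (c 0 - c h) in the ring, where e′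
  -- has the coefficients c′. The first summand sees g only through its coset sums.
  ∫-fold : ∀ {t e} → Invariant (ℓ ℕ.^ suc t) e →
    ∃ λ (c′ : ℕ → Carrier) → ∀ g → Periodic (ℓ ℕ.^ suc t) g →
      ∫ e g ≈ Σ< (ℓ ℕ.^ t) (λ j → c′ j * fold ℓ (ℓ ℕ.^ t) g j) + (coeff (suc t) e 0 - coeff (suc t) e (ℓ ℕ.^ t)) * g 0
  ∫-fold {t} {e} inv
    with c′ , formula ← Σ<-fold ℓ (ℓ ℕ.^ t) {{ℓ≢0}} {{ℓ^≢0 t}} (coeff (suc t) e)
                          (coefficient-class {t} {e} inv) (coefficient-multiple {t} {e} inv) =
    c′ , λ g per → trans (∫≈Σ-coefficient {{ℓ^≢0 (suc t)}} e per) (formula g)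

  -- With h = ℓ^(t-1), compare the coefficients c 0 and c h.  If they differ, any nonvanishing g
  -- whose sum over each coset of hℤ is zero is an eigenvector: ∫ e (shift i g) = (c 0 - c h) g(i).
  -- If they agree, e is h-periodic, and stays nonzero modulo X^h - 1 because ℓ is invertible.
  invariant⇒nonvanishing : ∀ t e → Invariant (ℓ ℕ.^ t) e →
    (∃ λ g → Periodic (ℓ ℕ.^ t) g × ¬ (∫ e g ≈ 0#)) →
    ∃ λ g → Periodic (ℓ ℕ.^ t) g × (∀ i → ¬ (∫ e (shift i g) ≈ 0#))
  -- The period is 1, so g is constant and all its shifts give the same nonzero value.
  invariant⇒nonvanishing zero e inv (g , per , ∫eg≉0) = g , per ,
    λ i eq → ∫eg≉0 (trans (∫-cong e (λ k → sym (periodic-mod {g = g} per (k , i ℕ.+ k , all-congruent i k)))) eq)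
    where
    all-congruent : ∀ i k → i ℕ.+ k ℕ.+ k ℕ.* 1 ≡ k ℕ.+ (i ℕ.+ k) ℕ.* 1
    all-congruent = solve 2 (λ i k → i :+ k :+ k :* con 1 := k :+ (i :+ k) :* con 1) ≡.refl
      where open +-*-Solver
  invariant⇒nonvanishing (suc t) e inv (g₀ , per₀ , ∫eg₀≉0)
    with c′ , ∫e≈ ← ∫-fold {t} {e} inv
    with coeff (suc t) e 0 ≟ coeff (suc t) e (ℓ ℕ.^ t)
  ... | no c0≉ch with g , per , g≉0 , fold≈0 ← nonvanishing-fold≈0 (ℓ ℕ.^ t) {{ℓ^≢0 t}} =
    g , per , λ i ∫≈0 → *-≉0 (c0≉ch ∘ x∙y⁻¹≈ε⇒x≈y _ _) (g≉0 (i ℕ.+ 0)) (trans (sym (eigen i)) ∫≈0)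
    where
    h : ℕ
    h = ℓ ℕ.^ t

    eigen : ∀ i → ∫ e (shift i g) ≈ (coeff (suc t) e 0 - coeff (suc t) e h) * g (i ℕ.+ 0)
    eigen i = begin
      ∫ e (shift i g)                                                   ≈⟨ ∫e≈ (shift i g) (periodic-shift {g = g} i per) ⟩
      Σ< h (λ j → c′ j * fold ℓ h (shift i g) j) + _ * g (i ℕ.+ 0)      ≈⟨ +-congʳ (Σ<-0 h (λ j _ → trans (*-congˡ (fold-shift≈0 j)) (zeroʳ (c′ j)))) ⟩
      0# + _ * g (i ℕ.+ 0)                                              ≈⟨ +-identityˡ _ ⟩
      _ * g (i ℕ.+ 0)                                                   ∎
      where
      fold-shift≈0 : ∀ j → fold ℓ h (shift i g) j ≈ 0#
      fold-shift≈0 j = trans (Σ<-cong ℓ (λ s _ → reflexive (≡.cong g (x∙yz≈y∙xz i (s ℕ.* h) j)))) (fold≈0 (i ℕ.+ j))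
        where open CommutativeSemigroupProperties ℕₚ.+-commutativeSemigroup using (x∙yz≈y∙xz)
  ... | yes c0≈ch =
    -- The same `e` is reread at period h. The induction also needs a function of period h on which
    -- `e` does not vanish; the coset sums of `g₀` provide it, because `∫ e ḡ₀` is ℓ times `∫ e g₀`.
    let g , per , nonvanishing = invariant⇒nonvanishing t e (λ g per → inv g (periodic-*ˡ {g = g} ℓ per)) (ḡ₀ , ḡ₀-periodic , ∫≉0)
    in g , periodic-*ˡ {g = g} ℓ per , nonvanishing
    where
    h : ℕ
    h = ℓ ℕ.^ t

    ḡ₀ : ℕ → Carrier
    ḡ₀ = fold ℓ h g₀

    ḡ₀-periodic : Periodic h ḡ₀
    ḡ₀-periodic = fold-periodic ℓ h per₀

    ∫e≈Σ : ∀ g → Periodic (ℓ ℕ.* h) g → ∫ e g ≈ Σ< h (λ j → c′ j * fold ℓ h g j)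
    ∫e≈Σ g per = trans (∫e≈ g per) (trans (+-congˡ (trans (*-congʳ (x≈y⇒x∙y⁻¹≈ε c0≈ch)) (zeroˡ (g 0)))) (+-identityʳ _))

    ∫eḡ₀≈ℓ∫eg₀ : ∫ e ḡ₀ ≈ ℓ · 1# * ∫ e g₀
    ∫eḡ₀≈ℓ∫eg₀ = begin
      ∫ e ḡ₀                                  ≈⟨ ∫e≈Σ ḡ₀ (periodic-*ˡ {g = ḡ₀} ℓ ḡ₀-periodic) ⟩
      Σ< h (λ j → c′ j * fold ℓ h ḡ₀ j)       ≈⟨ Σ<-cong h (λ j _ → trans (*-congˡ (fold-of-periodic {g = ḡ₀} ḡ₀-periodic j)) (x∙yz≈y∙xz (c′ j) (ℓ · 1#) (ḡ₀ j))) ⟩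
      Σ< h (λ j → ℓ · 1# * (c′ j * ḡ₀ j))     ≈⟨ Σ<-*ˡ h (ℓ · 1#) (λ j → c′ j * ḡ₀ j) ⟩
      ℓ · 1# * Σ< h (λ j → c′ j * ḡ₀ j)       ≈⟨ *-congˡ (∫e≈Σ g₀ per₀) ⟨
      ℓ · 1# * ∫ e g₀                         ∎
      where open CommutativeSemigroupProperties (CommutativeMonoid.commutativeSemigroup *-commutativeMonoid) using (x∙yz≈y∙xz)

    ∫≉0 : ¬ (∫ e ḡ₀ ≈ 0#)
    ∫≉0 eq = *-≉0 ℓ·1≉0 ∫eg₀≉0 (trans (sym ∫eḡ₀≈ℓ∫eg₀) eq)

  -- A nowhere vanishing g for the invariant multiple `w ⊛ s` becomes one for `w` after letting s
  -- act on it.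
  multiples-nonvanishing : ∀ {p k} → Prime p → q ≡ p ℕ.^ k → ∀ {t} → 1 ≤ t → ∀ w →
    (∃ λ g → Periodic (ℓ ℕ.^ t) g × ¬ (∫ w g ≈ 0#)) →
    ∃ λ g → Periodic (ℓ ℕ.^ t) g × (∀ i → ¬ (∫ w (shift i g) ≈ 0#))
  multiples-nonvanishing {p} {k} p-prime q≡p^k {t} 1≤t w (g₀ , per₀ , ∫wg₀≉0) =
    let s , inv , ws*w≋w = invariant-multiple {ℓ ℕ.^ t} {p} {k} p-prime q≡p^k {_} {totient (ℓ ℕ.^ t)} (≡.sym (ℕₚ.m+[n∸m]≡n 2≤q^φ)) (let _ , q^φ≡1 , _ = q-root t 1≤t in q^φ≡1) w
        g , per , nonvanishing = invariant⇒nonvanishing t (w ⊛ s) inv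
           -- The multiple `w ⊛ s` is nonzero: on this function it takes the value
           -- `∫ ((w ⊛ s) ⊛ w) g₀`, which is `∫ w g₀`.
           ( (λ i → ∫ w (shift i g₀))
           , ∫-periodic w (λ i l → g₀ (i ℕ.+ l)) (periodic-∙+ {g = g₀} per₀)
           , λ eq → ∫wg₀≉0 (trans (sym (ws*w≋w g₀ per₀)) (trans (∫-⊛ (w ⊛ s) w g₀) eq)))
    in
    (λ i → ∫ s (shift i g)) ,
    ∫-periodic s (λ i l → g (i ℕ.+ l)) (periodic-∙+ {g = g} per) ,
    λ i eq → nonvanishing i (begin
      ∫ (w ⊛ s) (shift i g)                              ≈⟨ ∫-⊛ w s (shift i g) ⟩
      ∫ w (λ j → ∫ s (λ l → g (i ℕ.+ (j ℕ.+ l))))        ≈⟨ ∫-cong w (λ j → ∫-cong s (λ l → reflexive (≡.cong g (ℕₚ.+-assoc i j l)))) ⟨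
      ∫ w (λ j → ∫ s (λ l → g (i ℕ.+ j ℕ.+ l)))          ≈⟨ eq ⟩
      0#                                                 ∎)
    where
    2≤q^φ : 2 ≤ q ℕ.^ totient (ℓ ℕ.^ t)
    2≤q^φ with totient (ℓ ℕ.^ t) | totient>0 {{ℓ^≢0 t}} (q-root t 1≤t)
    ... | suc φ | _ = ℕₚ.≤-trans (ℕₚ.≤-trans (ℕₚ.n≤1+n 2) 3≤q) (ℕₚ.m≤m*n q (q ℕ.^ φ) {{ℕₚ.m^n≢0 q φ {{ℕ.>-nonZero (ℕₚ.≤-trans (s≤s z≤n) 3≤q)}}}})

-- Orthogonality, and from nowhere zero pairings to covering subspaces

module Covering {q : ℕ} (F : FiniteField q) where
  open FiniteField F hiding (zero)
  open FieldProperties F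
  open GroupRing F
  open PeriodicSums F
  open Sum semiring
  private
    _≋_ : ∀ {n} → Vec F n → Vec F n → Set
    _≋_ = Defs._≋_ F
  open SetoidReasoning setoid
  open CommutativeSemigroupProperties (CommutativeMonoid.commutativeSemigroup *-commutativeMonoid) using (x∙yz≈y∙xz)
  open RingProperties (CommutativeRing.ring commRing) using (-‿distribˡ-*)

  infix 7 ⟨_,_⟩
  ⟨_,_⟩ : ∀ {n} → Vec F n → Vec F n → Carrier
  ⟨ w , v ⟩ = sum (λ i → w i * v i)

  -- Gaussian elimination: a vector s of S with s 0 ≉ 0 is used to clear the first coordinates.
  spans-or-orthogonal : ∀ n (S : List (Vec F n)) →
    (∀ U → IsSubspace F U → All U S → ∀ v → U v) ⊎
    (∃ λ w → (∃ λ i → ¬ (w i ≈ 0#)) × All (λ s → ⟨ w , s ⟩ ≈ 0#) S)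
  spans-or-orthogonal zero    S = inj₁ λ U sub _ v → IsSubspace.respects sub (λ ()) (IsSubspace.zero∈ sub)
  spans-or-orthogonal (suc n) S with all? (λ s → s zero ≟ 0#) S
  -- All first coordinates vanish, so the first standard basis vector is orthogonal to S.
  ... | yes S₀≈0 = inj₂ (1# Vector.∷ (λ _ → 0#) , (zero , 1≉0) , All.map (λ s₀≈0 →
    trans (+-cong (trans (*-identityˡ _) s₀≈0) (sum≈0 commutativeSemiring {n} _ (λ i → zeroˡ _))) (+-identityˡ 0#)) S₀≈0)
  ... | no ¬S₀≈0 with find (Allₚ.¬All⇒Any¬ (λ s → s zero ≟ 0#) S ¬S₀≈0)
  ...   | s , s∈S , s₀≉0 with inverse (s zero) s₀≉0
  ...     | s₀⁻¹ , s₀s₀⁻¹≈1 = eliminate (spans-or-orthogonal n (map reduce S))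
    where
    ratio : Vec F (suc n) → Carrier
    ratio v = v zero * s₀⁻¹

    reduce : Vec F (suc n) → Vec F n
    reduce v i = v (suc i) + - ratio v * s (suc i)

    ratio*s₀ : ∀ v → ratio v * s zero ≈ v zero
    ratio*s₀ v = trans (*-assoc _ _ _) (trans (*-congˡ (trans (*-comm _ _) s₀s₀⁻¹≈1)) (*-identityʳ _))

    reduce-zero : ∀ v → 0# ≈ v zero + - ratio v * s zero
    reduce-zero v = sym (trans (+-congˡ (trans (sym (-‿distribˡ-* _ _)) (-‿cong (ratio*s₀ v)))) (-‿inverseʳ (v zero)))

    reduce-restore : ∀ v → (λ i → (0# Vector.∷ reduce v) i + ratio v * s i) ≋ v
    reduce-restore v zero    = trans (+-identityˡ _) (ratio*s₀ v)
    reduce-restore v (suc i) = trans (+-assoc _ _ _) (trans (+-congˡ (trans (+-congʳ (sym (-‿distribˡ-* _ _))) (-‿inverseˡ _))) (+-identityʳ _))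

    eliminate : _ ⊎ _ → _
    eliminate (inj₁ spans) = inj₁ λ U sub S⊆U v →
      let open IsSubspace sub
          -- The slice of U at first coordinate 0. It contains the reduced vectors, so it is
          -- everything by induction, and multiples of s then restore the first coordinate.
          U′ : Vec F n → Set
          U′ u = U (0# Vector.∷ u)
          sub′ : IsSubspace F U′
          sub′ = record
            { respects = λ u≋v → respects λ { zero → refl ; (suc i) → u≋v i }
            ; zero∈    = respects (λ { zero → refl ; (suc i) → refl }) zero∈
            ; +-closed = λ u∈ v∈ → respects (λ { zero → +-identityˡ 0# ; (suc i) → refl }) (+-closed u∈ v∈)
            ; ·-closed = λ c u∈ → respects (λ { zero → zeroʳ c ; (suc i) → refl }) (·-closed c u∈)
            }
          reduced : ∀ {u} → U u → U′ (reduce u)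
          reduced {u} u∈U = respects (λ { zero → sym (reduce-zero u) ; (suc i) → refl })
                              (+-closed u∈U (·-closed (- ratio u) (All.lookup S⊆U s∈S)))
      in respects (reduce-restore v)
           (+-closed (spans U′ sub′ (Allₚ.map⁺ (All.map reduced S⊆U)) (reduce v)) (·-closed (ratio v) (All.lookup S⊆U s∈S)))
    eliminate (inj₂ (w , (i , wᵢ≉0) , w⊥S)) = inj₂
      (c Vector.∷ w , (suc i , wᵢ≉0) , All.map (λ {v} eq → trans (sym (⟨w,reduce⟩ v)) eq) (Allₚ.map⁻ w⊥S))
      where
      -- This is the value that makes (c, w) orthogonal to s; then (c, w) pairs with v as w pairs
      -- with `reduce v`, since the two differ by a multiple of s.
      c : Carrier
      c = - (s₀⁻¹ * ⟨ w , s ∘ suc ⟩)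

      ⟨w,reduce⟩ : ∀ v → ⟨ w , reduce v ⟩ ≈ ⟨ c Vector.∷ w , v ⟩
      ⟨w,reduce⟩ v = begin
        sum (λ i → w i * (v (suc i) + - ratio v * s (suc i)))   ≈⟨ sum-cong-≋ {n} (λ i → trans (distribˡ _ _ _) (+-congˡ (x∙yz≈y∙xz (w i) (- ratio v) (s (suc i))))) ⟩
        sum (λ i → w i * v (suc i) + - ratio v * (w i * s (suc i))) ≈⟨ ∑-distrib-+ {n} (λ i → w i * v (suc i)) (λ i → - ratio v * (w i * s (suc i))) ⟩
        ⟨ w , v ∘ suc ⟩ + sum (λ i → - ratio v * (w i * s (suc i))) ≈⟨ +-congˡ (*-distribˡ-sum {n} (- ratio v) (λ i → w i * s (suc i))) ⟨
        ⟨ w , v ∘ suc ⟩ + - ratio v * ⟨ w , s ∘ suc ⟩           ≈⟨ +-comm _ _ ⟩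
        - ratio v * ⟨ w , s ∘ suc ⟩ + ⟨ w , v ∘ suc ⟩           ≈⟨ +-congʳ (trans (sym (-‿distribˡ-* _ _)) (trans (-‿cong (trans (*-assoc _ _ _) (*-comm _ _))) (-‿distribˡ-* _ _))) ⟩
        c * v zero + ⟨ w , v ∘ suc ⟩                            ∎

  allVectors : ∀ n → List (Vec F n)
  allVectors zero    = Vector.[] ∷ []
  allVectors (suc n) = cartesianProductWith Vector._∷_ (tabulate (Inverse.to enum)) (allVectors n)

  allVectors-complete : ∀ n v → ∃ λ u → u ∈ allVectors n × (u ≋ v)
  allVectors-complete zero    v = Vector.[] , here ≡.refl , λ ()
  allVectors-complete (suc n) v with u , u∈ , u≋ ← allVectors-complete n (v ∘ suc) =
    Inverse.to enum v₀ Vector.∷ u ,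
    ∈-cartesianProductWith⁺ Vector._∷_ (∈-tabulate⁺ v₀) u∈ ,
    λ { zero → Inverse.inverseˡ enum ≡.refl ; (suc i) → u≋ i }
    where
    v₀ : Fin q
    v₀ = Inverse.from enum (v zero)

  -- τ moves entry k to place k + 1, so entry k of u is g(k + 1). The last entry lands at place 0,
  -- where periodicity gives g(0) = g(n).
  τ-unshift : ∀ {n g} → Periodic n g → ∀ {u} → τ F {n} u ≋ (g ∘ toℕ) → u ≋ (g ∘ suc ∘ toℕ)
  τ-unshift {suc m} {g} per {u} τu≋g k with view k
  ... | ‵fromℕ     = trans (τu≋g zero) (trans (sym (per 0)) (reflexive (≡.cong (g ∘ suc) (≡.sym (toℕ-fromℕ m)))))
  ... | ‵inject₁ j = trans (τu≋g (suc j)) (reflexive (≡.cong (g ∘ suc) (≡.sym (toℕ-inject₁ j))))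

  τ^-unshift : ∀ {n g} → Periodic n g → ∀ i {u} → τ^ F {n} i u ≋ (g ∘ toℕ) → u ≋ (shift i g ∘ toℕ)
  τ^-unshift per zero    u≋g   = u≋g
  τ^-unshift {g = g} per (suc i) τu≋g = τ^-unshift {g = g ∘ suc} (per ∘ suc) i (τ-unshift {g = g} per τu≋g)

  fromVec : ∀ {n} → Vec F n → Poly
  fromVec w = tabulate (λ i → w i , toℕ i)

  ∫-fromVec : ∀ {n} (w : Vec F n) g → ∫ (fromVec w) g ≈ ⟨ w , g ∘ toℕ ⟩
  ∫-fromVec w g = ∫-tabulate w toℕ
    where
    ∫-tabulate : ∀ {n} (w : Vec F n) (k : Fin n → ℕ) → ∫ (tabulate (λ i → w i , k i)) g ≈ ⟨ w , g ∘ k ⟩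
    ∫-tabulate {zero}  w k = refl
    ∫-tabulate {suc n} w k = +-congˡ (∫-tabulate (w ∘ suc) (k ∘ suc))

  fromVec-nonzero : ∀ {n} .{{_ : NonZero n}} (w : Vec F n) i → ¬ (w i ≈ 0#) → ∃ λ g → Periodic n g × ¬ (∫ (fromVec w) g ≈ 0#)
  fromVec-nonzero {n} w i wᵢ≉0 = δ {n} (toℕ i) , δ-periodic (toℕ i) , λ eq → wᵢ≉0 (trans (sym ∫≈wᵢ) eq)
    where
    ∫≈wᵢ : ∫ (fromVec w) (δ {n} (toℕ i)) ≈ w i
    ∫≈wᵢ = begin
      ∫ (fromVec w) (δ (toℕ i))             ≈⟨ ∫-fromVec w (δ (toℕ i)) ⟩
      sum (λ j → w j * δ (toℕ i) (toℕ j))   ≈⟨ sum-pick i _ (λ j j≢i → trans (*-congˡ (δ≈0 (λ eq → j≢i (toℕ-injective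
                                                 (≡.trans (≡.sym (m<n⇒m%n≡m (toℕ<n j))) (≡.trans eq (m<n⇒m%n≡m (toℕ<n i)))))))) (zeroʳ (w j))) ⟩
      w i * δ (toℕ i) (toℕ i)               ≈⟨ *-congˡ (δ≈1 {n} {toℕ i} ≡.refl) ⟩
      w i * 1#                              ≈⟨ *-identityʳ (w i) ⟩
      w i                                   ∎

  -- If some w ≠ 0 were orthogonal to the chosen elements of U, take its g as a vector. The covering
  -- yields a chosen u with τʲu = g, so u is g shifted by j and pairs to a nonzero value with w,
  -- contradicting orthogonality.
  nonvanishing⇒hZero : ∀ {n} → (∀ w i → ¬ (w i ≈ 0#) → ∃ λ g → Periodic n g × (∀ i → ¬ (∫ (fromVec {n} w) (shift i g) ≈ 0#))) → hZero F n
  nonvanishing⇒hZero {n} nonvanishing U sub cover = conclude (spans-or-orthogonal n S)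
    where
    -- U need not be decidable; S collects the finitely many elements of U that the covering provides.
    preimage : Vec F n → Vec F n
    preimage v = let _ , _ , u , _ = cover v in u

    S : List (Vec F n)
    S = map preimage (allVectors n)

    S⊆U : All U S
    S⊆U = Allₚ.map⁺ (All.universal (λ v → let _ , _ , _ , u∈U , _ = cover v in u∈U) (allVectors n))

    conclude : _ ⊎ _ → ∀ v → U v
    conclude (inj₁ spans) = spans U sub S⊆U
    conclude (inj₂ (w , (i , wᵢ≉0) , w⊥S))
      with g , per , ∫≉0 ← nonvanishing w i wᵢ≉0
      with v , v∈ , v≋g ← allVectors-complete n (g ∘ toℕ)
      with cover v | All.lookup w⊥S (∈-map⁺ preimage v∈)
    ... | j , _ , u , _ , τ^u≋v | w⊥u = contradiction
      (begin
        ∫ (fromVec w) (shift j g)     ≈⟨ ∫-fromVec w (shift j g) ⟩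
        ⟨ w , shift j g ∘ toℕ ⟩       ≈⟨ sum-cong-≋ {n} (λ k → *-congˡ (τ^-unshift {g = g} per j (λ k → trans (τ^u≋v k) (v≋g k)) k)) ⟨
        ⟨ w , u ⟩                     ≈⟨ w⊥u ⟩
        0#                            ∎)
      (∫≉0 j)

open import Data.Nat using (_^_)

theorem3p3 : (p k q : ℕ) → Prime p → 1 ≤ k → q ≡ p ^ k → q ≢ 2 → q ≢ p ^ 2 →
    (ℓ : ℕ) → Prime ℓ → ℓ ≢ 2 →
    (∀ t → 1 ≤ t → PrimitiveRoot q (ℓ ^ t)) →
    (F : FiniteField q) → (t : ℕ) → 1 ≤ t → hZero F (ℓ ^ t)
theorem3p3 p k@(suc k′) q p-prime 1≤k q≡p^k q≢2 _ ℓ ℓ-prime ℓ≢2 q-root F t 1≤t =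
  nonvanishing⇒hZero λ w i wᵢ≉0 →
    multiples-nonvanishing {p} {k} p-prime q≡p^k 1≤t (fromVec w)
      (fromVec-nonzero {{ℕₚ.m^n≢0 ℓ t {{prime⇒nonZero ℓ-prime}}}} w i wᵢ≉0)
  where
  2≤q : 2 ≤ q
  2≤q = ≡.subst (2 ≤_) (≡.sym q≡p^k)
    (ℕₚ.≤-trans (ℕ.nonTrivial⇒n>1 p {{prime⇒nonTrivial p-prime}})
                (ℕₚ.m≤m*n p (p ^ k′) {{ℕₚ.m^n≢0 p k′ {{prime⇒nonZero p-prime}}}}))

  open Covering F
  open NowhereZero F (ℕₚ.≤∧≢⇒< 2≤q (q≢2 ∘ ≡.sym)) ℓ-prime ℓ≢2 q-root
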